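{- For any integers $d\ge 1$ and $h>3$ there exists a finite graph $G$ with diameter $d$ and $\hat\mu(G)=h$.
   Context: All graphs are finite and simple. A generalized hat guessing game $\langle G,h,g\rangle$, for a graph $G=(V,E)$ and positive integers $h,g$ (constant hatness and number of guesses): an adversary assigns to each vertex a color in $\{0,\dots,h-1\}$; each vertex sees the colors of its neighbours and, by a deterministic strategy fixed in advance, outputs a set of $g$ guesses for its own color; the game is winning if there is a strategy such that for every coloring at least one vertex's color is among its guesses. The fractional hat chromatic number is $\hat\mu(G)=\sup\{h/g : \langle G,h,g\rangle \text{ is winning}\}$. -}

module Defs where

open import Data.Nat using (ℕ; zero; suc; _+_; _*_; _≤_; _<_)
open import Data.Fin using (Fin)
open import Data.Fin.Subset using (Subset; _∈_; ∣_∣)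
open import Data.Bool using (Bool; true; false)
open import Data.Product using (Σ; ∃; ∃-syntax; _×_; _,_)
open import Relation.Binary.PropositionalEquality using (_≡_)
open import Relation.Nullary using (¬_)

record Graph : Set where
  field
    n     : ℕ
    adj   : Fin n → Fin n → Bool
    sym   : ∀ u v → adj u v ≡ adj v u
    irrefl : ∀ v → adj v v ≡ false

open Graph public

data Walk (G : Graph) : Fin (n G) → Fin (n G) → ℕ → Set where
  here : ∀ {u} → Walk G u u zero
  step : ∀ {u w v k} → adj G u w ≡ true → Walk G w v k → Walk G u v (suc k)

DistLe : (G : Graph) → Fin (n G) → Fin (n G) → ℕ → Set
DistLe G u v k = ∃[ m ] (m ≤ k × Walk G u v m)

HasDiameter : Graph → ℕ → Set
HasDiameter G d =
  (∀ u v → DistLe G u v d) ×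
  (∃[ u ] ∃[ v ] (∀ m → m < d → ¬ Walk G u v m))

Coloring : Graph → ℕ → Set
Coloring G h = Fin (n G) → Fin h

Strategy : Graph → ℕ → Set
Strategy G h = (v : Fin (n G)) → Coloring G h → Subset h

Local : (G : Graph) (h : ℕ) → Strategy G h → Set
Local G h f = ∀ v (c c' : Coloring G h) →
  (∀ u → adj G v u ≡ true → c u ≡ c' u) → f v c ≡ f v c'

HasGuesses : (G : Graph) (h g : ℕ) → Strategy G h → Set
HasGuesses G h g f = ∀ v (c : Coloring G h) → ∣ f v c ∣ ≡ g

Winning : Graph → ℕ → ℕ → Set
Winning G h g = ∃[ f ] (Local G h f × HasGuesses G h g f ×
  (∀ (c : Coloring G h) → ∃[ v ] (c v ∈ f v c)))

-- μ̂(G) = sup { h'/g : h',g ≥ 1, ⟨G,h',g⟩ winning } equals the natural number h: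
-- (i) h is an upper bound: every winning ⟨G,h',g⟩ has h'/g ≤ h;
-- (ii) it is the least upper bound: for every rational p/q < h (q ≥ 1)
--      there is a winning ⟨G,h',g⟩ with h'/g > p/q.
FracHatChromaticEq : Graph → ℕ → Set
FracHatChromaticEq G h =
  (∀ h' g → 1 ≤ h' → 1 ≤ g → Winning G h' g → h' ≤ h * g) ×
  (∀ p q → 1 ≤ q → p < h * q →
     ∃[ h' ] ∃[ g ] (1 ≤ h' × 1 ≤ g × Winning G h' g × p * g < h' * q))

{-# OPTIONS --safe #-}
module Submission where

-- The witnesses are interval graphs. Ordered by right end points, each vertex p is adjacent to a
-- clique of later vertices. Suppose each vertex p has a weight x_p ≤ 1 with
--   1 / h = x_v ∏ (1 − x_p)   over the earlier neighbours p of v, for every v,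
-- and that some vertex has weight 1.
-- Winning with h = colours / guesses: write x_p = a_p / b_p and let a colour be a vector with one
-- digit modulo b_p for each p. Let σ_p be the sum modulo b_p of the p-th digits of p and its later
-- neighbours. A vertex v bets that σ_v < a_v and that σ_p ≥ a_p for all earlier neighbours p; the
-- first p with σ_p < a_p is right, and there is one because some x_p is 1.
-- Losing for every larger ratio: a Lovász local lemma. For a random colouring, eliminating the
-- vertices in order and conditioning on their being wrong divides the probability that a later
-- neighbour of p is right by at most 1 − x_p, so these probabilities stay below x_v.
-- The graph of diameter d is a chain of cliques whose cut vertices have weights alternately 1 / 2
-- and 2 / h; for even d the first clique is replaced by three cliques with a common vertex.

open import Defs hiding (sym)
open import Data.Bool as Bool using (Bool; true; false; not; _∧_; _∨_; if_then_else_)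
open import Data.Bool.Properties using (T-≡; ∧-comm)
open import Data.Fin as Fin using (Fin; zero; suc; toℕ; fromℕ; fromℕ<; inject₁; _↑ˡ_; _↑ʳ_; combine; remQuot)
open import Data.Fin.Properties as Finₚ
  using (toℕ<n; toℕ-fromℕ; toℕ-fromℕ<; toℕ-injective; toℕ-inject₁; toℕ-↑ˡ; toℕ-↑ʳ; remQuot-combine)
open import Data.Fin.Subset using (Subset; ∣_∣; _∈_; _∉_)
open import Data.Fin.Subset.Properties using (_∈?_)
open import Data.List using (List; []; _∷_; _++_; length)
open import Data.List.Relation.Unary.All as All using (All; []; _∷_)
open import Data.List.Relation.Unary.All.Properties as Allₚ using ()
open import Data.List.Relation.Unary.Any as Any using (Any; here; there)
open import Data.List.Relation.Unary.Any.Properties as Anyₚ using ()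
open import Data.Nat using (ℕ; zero; suc; _+_; _*_; _⊔_; _≤_; _<_; _<ᵇ_; _≤ᵇ_; _≡ᵇ_; z≤n; s≤s; _%_; NonZero; >-nonZero)
open import Data.Nat.DivMod using (m<n⇒m%n≡m; [m+n]%n≡m%n; m%n<n)
open import Data.Nat.Properties
open import Data.Nat.Tactic.RingSolver using (solve-∀)
open import Data.Product using (∃-syntax; _×_; _,_; proj₁; proj₂)
open import Data.Sum using (_⊎_; inj₁; inj₂; [_,_]′)
open import Data.Vec using (Vec; []; _∷_; tabulate; lookup; _[_]≔_)
open import Data.Vec.Functional using (updateAt)
open import Data.Vec.Functional.Properties using (updateAt-updates; updateAt-minimal)
open import Data.Vec.Properties
  using (lookup∘tabulate; tabulate∘lookup; tabulate-cong; lookup⇒[]=; []=⇒lookup; lookup∘update; lookup∘update′)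
open import Function using (_∘_; const; Equivalence)
open import Relation.Binary.Definitions using (tri<; tri≈; tri>)
open import Relation.Binary.PropositionalEquality
open import Relation.Nullary using (¬_; Dec; yes; no; does; contradiction; ¬?; _→-dec_)
open import Algebra.Properties.Semiring.Sum +-*-semiring
  using (sum; sum-cong-≗; ∑-comm; ∑-distrib-+; sum-init-last; *-distribˡ-sum; *-distribʳ-sum)

-- Booleans as numbers, and Boolean comparisons

⟦_⟧ : Bool → ℕ
⟦ true ⟧ = 1
⟦ false ⟧ = 0

⟦∧⟧ : ∀ x y → ⟦ x ∧ y ⟧ ≡ ⟦ x ⟧ * ⟦ y ⟧
⟦∧⟧ true y = sym (+-identityʳ ⟦ y ⟧)
⟦∧⟧ false y = refl

∧-true : ∀ {x y} → x ∧ y ≡ true → x ≡ true × y ≡ true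
∧-true {true} {true} _ = refl , refl

<ᵇ-true : ∀ {m n} → m < n → (m <ᵇ n) ≡ true
<ᵇ-true p = Equivalence.to T-≡ (<⇒<ᵇ p)

<ᵇ-true⁻¹ : ∀ {m n} → (m <ᵇ n) ≡ true → m < n
<ᵇ-true⁻¹ {m} {n} e = <ᵇ⇒< m n (Equivalence.from T-≡ e)

<ᵇ-false : ∀ {m n} → n ≤ m → (m <ᵇ n) ≡ false
<ᵇ-false {m} {n} q with m <ᵇ n in e
... | true = contradiction (<ᵇ-true⁻¹ {m} {n} e) (≤⇒≯ q)
... | false = refl

≡ᵇ-refl : ∀ n → (n ≡ᵇ n) ≡ true
≡ᵇ-refl n = Equivalence.to T-≡ (≡⇒≡ᵇ n n refl)

≡ᵇ-true⁻¹ : ∀ {m n} → (m ≡ᵇ n) ≡ true → m ≡ n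
≡ᵇ-true⁻¹ {m} {n} e = ≡ᵇ⇒≡ m n (Equivalence.from T-≡ e)

≡ᵇ-false : ∀ {m n} → m ≢ n → (m ≡ᵇ n) ≡ false
≡ᵇ-false {m} {n} m≢n with m ≡ᵇ n in e
... | true = contradiction (≡ᵇ-true⁻¹ e) m≢n
... | false = refl

-- Sums over Fin

∣tabulate∣ : ∀ {n} (P : Fin n → Bool) → ∣ tabulate P ∣ ≡ sum (⟦_⟧ ∘ P)
∣tabulate∣ {zero} P = refl
∣tabulate∣ {suc n} P with P zero
... | true = cong suc (∣tabulate∣ (P ∘ suc))
... | false = ∣tabulate∣ (P ∘ suc)

sum-mono : ∀ {n} {f g : Fin n → ℕ} → (∀ i → f i ≤ g i) → sum f ≤ sum g
sum-mono {zero} f≤g = z≤n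
sum-mono {suc n} f≤g = +-mono-≤ (f≤g zero) (sum-mono (f≤g ∘ suc))

sum-const : ∀ n k → sum {n} (const k) ≡ n * k
sum-const zero k = refl
sum-const (suc n) k = cong (k +_) (sum-const n k)

sum-split : ∀ m {n} (f : Fin (m + n) → ℕ) → sum f ≡ sum (λ i → f (i ↑ˡ n)) + sum (λ j → f (m ↑ʳ j))
sum-split zero f = refl
sum-split (suc m) f = trans (cong (f zero +_) (sum-split m (f ∘ suc))) (sym (+-assoc (f zero) _ _))

sum-combine : ∀ m {n} (f : Fin (m * n) → ℕ) → sum f ≡ sum {m} (λ i → sum {n} (λ j → f (combine i j)))
sum-combine zero f = refl
sum-combine (suc m) {n} f = trans (sum-split n f) (cong (sum (λ j → f (j ↑ˡ m * n)) +_) (sum-combine m (λ j → f (n ↑ʳ j))))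

sum-update : ∀ {n} (v : Fin n) {f g : Fin n → ℕ} → (∀ u → u ≢ v → f u ≡ g u) → sum f + g v ≡ sum g + f v
sum-update {suc n} zero {f} {g} e =
  trans (cong (λ s → f zero + s + g zero) (sum-cong-≗ (λ i → e (suc i) λ ())))
        (swap (f zero) (sum (g ∘ suc)) (g zero))
  where
  swap : ∀ x y z → x + y + z ≡ z + y + x
  swap = solve-∀
sum-update {suc n} (suc v) {f} {g} e = begin
  f zero + sum (f ∘ suc) + g (suc v)   ≡⟨ +-assoc (f zero) _ _ ⟩
  f zero + (sum (f ∘ suc) + g (suc v)) ≡⟨ cong₂ _+_ (e zero λ ()) (sum-update v (λ u u≢v → e (suc u) (u≢v ∘ Finₚ.suc-injective))) ⟩
  g zero + (sum (g ∘ suc) + f (suc v)) ≡⟨ +-assoc (g zero) _ _ ⟨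
  g zero + sum (g ∘ suc) + f (suc v)   ∎
  where open ≡-Reasoning

-- Raising s by one moves a single term around the cycle: the old first term followed by the new sum
-- is a run of `b + 1` consecutive terms, whose first and last agree modulo b.
sum-rotate : ∀ b .{{_ : NonZero b}} (F : ℕ → ℕ) s →
             sum {b} (λ y → F ((s + toℕ y) % b)) ≡ sum {b} (λ y → F (toℕ y))
sum-rotate b F zero = sum-cong-≗ {b} λ y → cong F (m<n⇒m%n≡m (toℕ<n y))
sum-rotate b F (suc s) = trans (+-cancelˡ-≡ (t zero) _ _ shift) (sum-rotate b F s)
  where
  open ≡-Reasoning
  t : Fin (suc b) → ℕ
  t y = F ((s + toℕ y) % b)
  shift : t zero + sum {b} (λ y → F ((suc s + toℕ y) % b)) ≡ t zero + sum {b} (λ y → F ((s + toℕ y) % b))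
  shift = begin
    t zero + sum {b} (λ y → F ((suc s + toℕ y) % b))
      ≡⟨ cong (t zero +_) (sum-cong-≗ {b} λ y → cong (λ k → F (k % b)) (sym (+-suc s (toℕ y)))) ⟩
    sum t
      ≡⟨ sum-init-last t ⟩
    sum {b} (t ∘ inject₁) + t (fromℕ b)
      ≡⟨ cong₂ _+_ (sum-cong-≗ {b} λ y → cong (λ k → F ((s + k) % b)) (toℕ-inject₁ y))
                   (cong F (trans (cong (λ k → (s + k) % b) (toℕ-fromℕ b))
                     (trans ([m+n]%n≡m%n s b) (cong (_% b) (sym (+-identityʳ s)))))) ⟩
    sum {b} (λ y → F ((s + toℕ y) % b)) + t zero
      ≡⟨ +-comm _ (t zero) ⟩
    t zero + sum {b} (λ y → F ((s + toℕ y) % b)) ∎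

count-< : ∀ a k → sum {a + k} (λ y → ⟦ toℕ y <ᵇ a ⟧) ≡ a
count-< a k = begin
  sum {a + k} (λ y → ⟦ toℕ y <ᵇ a ⟧)
    ≡⟨ sum-split a _ ⟩
  sum {a} (λ i → ⟦ toℕ (i ↑ˡ k) <ᵇ a ⟧) + sum {k} (λ j → ⟦ toℕ (a ↑ʳ j) <ᵇ a ⟧)
    ≡⟨ cong₂ _+_ (sum-cong-≗ {a} λ i → cong ⟦_⟧ (<ᵇ-true (subst (_< a) (sym (toℕ-↑ˡ i k)) (toℕ<n i))))
                 (sum-cong-≗ {k} λ j → cong ⟦_⟧ (<ᵇ-false (subst (a ≤_) (sym (toℕ-↑ʳ a j)) (m≤m+n a _)))) ⟩
  sum {a} (const 1) + sum {k} (const 0)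
    ≡⟨ cong₂ _+_ (trans (sum-const a 1) (*-identityʳ a)) (trans (sum-const k 0) (*-zeroʳ k)) ⟩
  a + 0
    ≡⟨ +-identityʳ a ⟩
  a ∎
  where open ≡-Reasoning

count-≮ : ∀ a k → sum {a + k} (λ y → ⟦ not (toℕ y <ᵇ a) ⟧) ≡ k
count-≮ a k = +-cancelˡ-≡ a _ _ (begin
  a + sum {a + k} (λ y → ⟦ not (toℕ y <ᵇ a) ⟧)
    ≡⟨ cong (_+ sum {a + k} (λ y → ⟦ not (toℕ y <ᵇ a) ⟧)) (count-< a k) ⟨
  sum {a + k} (λ y → ⟦ toℕ y <ᵇ a ⟧) + sum {a + k} (λ y → ⟦ not (toℕ y <ᵇ a) ⟧)
    ≡⟨ ∑-distrib-+ {a + k} _ _ ⟨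
  sum {a + k} (λ y → ⟦ toℕ y <ᵇ a ⟧ + ⟦ not (toℕ y <ᵇ a) ⟧)
    ≡⟨ sum-cong-≗ {a + k} (λ y → complement (toℕ y <ᵇ a)) ⟩
  sum {a + k} (const 1)
    ≡⟨ trans (sum-const (a + k) 1) (*-identityʳ (a + k)) ⟩
  a + k ∎)
  where
  open ≡-Reasoning
  complement : ∀ x → ⟦ x ⟧ + ⟦ not x ⟧ ≡ 1
  complement true = refl
  complement false = refl

-- Products and conjunctions over initial segments of ℕ

Π : ℕ → (ℕ → ℕ) → ℕ
Π zero f = 1
Π (suc t) f = Π t f * f t

Π-cong : ∀ t {f g : ℕ → ℕ} → (∀ p → p < t → f p ≡ g p) → Π t f ≡ Π t g
Π-cong zero e = refl
Π-cong (suc t) e = cong₂ _*_ (Π-cong t (λ p p<t → e p (m<n⇒m<1+n p<t))) (e t ≤-refl)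

Π-positive : ∀ t {f : ℕ → ℕ} → (∀ p → 0 < f p) → 0 < Π t f
Π-positive zero pos = s≤s z≤n
Π-positive (suc t) pos = *-mono-< (Π-positive t pos) (pos t)

allBelow : ℕ → (ℕ → Bool) → Bool
allBelow zero P = true
allBelow (suc t) P = allBelow t P ∧ P t

allBelow-cong : ∀ t {P Q : ℕ → Bool} → (∀ p → p < t → P p ≡ Q p) → allBelow t P ≡ allBelow t Q
allBelow-cong zero e = refl
allBelow-cong (suc t) e = cong₂ _∧_ (allBelow-cong t (λ p p<t → e p (m<n⇒m<1+n p<t))) (e t ≤-refl)

allBelow-true : ∀ t {P : ℕ → Bool} → (∀ p → p < t → P p ≡ true) → allBelow t P ≡ true
allBelow-true zero e = refl
allBelow-true (suc t) e = cong₂ _∧_ (allBelow-true t (λ p p<t → e p (m<n⇒m<1+n p<t))) (e t ≤-refl)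

least : ∀ (P : ℕ → Bool) t → (∀ p → p < t → P p ≡ false) ⊎
        (∃[ v ] (v < t × P v ≡ true × (∀ p → p < v → P p ≡ false)))
least P zero = inj₁ λ _ ()
least P (suc t) with least P t
... | inj₂ (v , v<t , rest) = inj₂ (v , m<n⇒m<1+n v<t , rest)
... | inj₁ none with P t in eq
...   | true = inj₂ (t , ≤-refl , eq , none)
...   | false = inj₁ λ p p<1+t → case-≤ p (m≤n⇒m<n∨m≡n (≤-pred p<1+t))
  where
  case-≤ : ∀ p → p < t ⊎ p ≡ t → P p ≡ false
  case-≤ p (inj₁ p<t) = none p p<t
  case-≤ p (inj₂ refl) = eq

-- Mixed-radix digits of a colour

module Digits (b : ℕ → ℕ) where

  digit : ∀ t → Fin (Π t b) → ℕ → ℕ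
  digit zero x p = 0
  digit (suc t) x p = if p ≡ᵇ t then toℕ (proj₂ (remQuot {Π t b} (b t) x)) else digit t (proj₁ (remQuot {Π t b} (b t) x)) p

  digit-top : ∀ t (i : Fin (Π t b)) (j : Fin (b t)) → digit (suc t) (combine i j) t ≡ toℕ j
  digit-top t i j rewrite ≡ᵇ-refl t = cong (toℕ ∘ proj₂) (remQuot-combine i j)

  digit-below : ∀ t (i : Fin (Π t b)) (j : Fin (b t)) {p} → p < t → digit (suc t) (combine i j) p ≡ digit t i p
  digit-below t i j {p} p<t rewrite ≡ᵇ-false (<⇒≢ p<t) = cong (λ q → digit t (proj₁ q) p) (remQuot-combine i j)

  -- The digits of a uniform x are independent, so the count factorises; the induction splits off
  -- the digit of highest index.
  count-box : ∀ (Q : ℕ → ℕ → Bool) (w : ℕ → ℕ) → (∀ p → sum {b p} (λ y → ⟦ Q p (toℕ y) ⟧) ≡ w p) →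
              ∀ t → sum {Π t b} (λ x → ⟦ allBelow t (λ p → Q p (digit t x p)) ⟧) ≡ Π t w
  count-box Q w counts zero = refl
  count-box Q w counts (suc t) = begin
    sum {Π t b * b t} (λ x → ⟦ allBelow (suc t) (λ p → Q p (digit (suc t) x p)) ⟧)
      ≡⟨ sum-combine (Π t b) _ ⟩
    sum {Π t b} (λ i → sum {b t} (λ j → ⟦ allBelow (suc t) (λ p → Q p (digit (suc t) (combine i j) p)) ⟧))
      ≡⟨ sum-cong-≗ {Π t b} (λ i → sum-cong-≗ {b t} (λ j → factor i j)) ⟩
    sum {Π t b} (λ i → sum {b t} (λ j → X i * Y j))
      ≡⟨ sum-cong-≗ {Π t b} (λ i → *-distribˡ-sum {b t} (X i) Y) ⟨
    sum {Π t b} (λ i → X i * sum {b t} Y)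
      ≡⟨ *-distribʳ-sum {Π t b} (sum {b t} Y) X ⟨
    sum {Π t b} X * sum {b t} Y
      ≡⟨ cong₂ _*_ (count-box Q w counts t) (counts t) ⟩
    Π t w * w t ∎
    where
    open ≡-Reasoning
    X : Fin (Π t b) → ℕ
    X i = ⟦ allBelow t (λ p → Q p (digit t i p)) ⟧
    Y : Fin (b t) → ℕ
    Y j = ⟦ Q t (toℕ j) ⟧
    factor : ∀ i j → ⟦ allBelow (suc t) (λ p → Q p (digit (suc t) (combine i j) p)) ⟧ ≡ X i * Y j
    factor i j = trans
      (cong ⟦_⟧ (cong₂ _∧_ (allBelow-cong t (λ p p<t → cong (Q p) (digit-below t i j p<t)))
                           (cong (Q t) (digit-top t i j))))
      (⟦∧⟧ (allBelow t _) _)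

if-true : ∀ {x} {y z : ℕ} → x ≡ true → (if x then y else z) ≡ y
if-true refl = refl

-- The vertex p gets the weight a p / b p with a p = 1 + α p and b p = a p + κ p, so that
-- 1 − weight = κ p / b p.
record CriticalWeights (h n : ℕ) : Set where
  field
    A          : ℕ → ℕ → Bool
    A-sym      : ∀ p q → A p q ≡ A q p
    A-irrefl   : ∀ p → A p p ≡ false
    α κ        : ℕ → ℕ

  a : ℕ → ℕ
  a p = suc (α p)

  b : ℕ → ℕ
  b p = a p + κ p

  field
    simplicial : ∀ {p j k} → p < j → p < k → j < n → k < n →
                 A p j ≡ true → A p k ≡ true → j ≢ k → A j k ≡ true
    -- The equation 1 / h = x_v ∏ (1 - x_p) with denominators cleared: a vertex p < v not adjacent
    -- to v contributes the same factor `b p` to both sides.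
    critical   : ∀ {v} → v < n →
                 h * a v * Π v (λ p → if A p v then κ p else b p) ≡ b v * Π v b
    final      : ∃[ z ] (z < n × κ z ≡ 0)

  graph : Graph
  graph = record
    { n = n ; adj = λ u v → A (toℕ u) (toℕ v)
    ; sym = λ u v → A-sym (toℕ u) (toℕ v) ; irrefl = λ v → A-irrefl (toℕ v) }

-- The winning strategy

module _ {h n : ℕ} (W : CriticalWeights h n) where
  open CriticalWeights W
  open Digits b

  Colour : Set
  Colour = Fin (Π n b)

  near : ℕ → ℕ → Bool
  near p u = (p ≡ᵇ u) ∨ ((p <ᵇ u) ∧ A p u)

  σ : ℕ → (Fin n → Colour) → ℕ
  σ p c = sum (λ u → if near p (toℕ u) then digit n (c u) p else 0)

  test : ℕ → ℕ → ℕ → Bool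
  test v p y = if p ≡ᵇ v then y <ᵇ a p else (if (p <ᵇ v) ∧ A p v then not (y <ᵇ a p) else true)

  right : Fin n → (Fin n → Colour) → Bool
  right v c = allBelow n (λ p → test (toℕ v) p (σ p c % b p))

  recolour : (Fin n → Colour) → Fin n → Colour → Fin n → Colour
  recolour c v x = updateAt c v (const x)

  -- Each candidate x overwrites the own colour of v, so the guess cannot depend on that colour.
  guess : Strategy graph (Π n b)
  guess v c = tabulate (λ x → right v (recolour c v x))

  -- The number of residues modulo `b p` that pass `test v p`.
  share : ℕ → ℕ → ℕ
  share v p = if p ≡ᵇ v then a p else (if (p <ᵇ v) ∧ A p v then κ p else b p)

  test-count : ∀ v p s → sum {b p} (λ y → ⟦ test v p ((s + toℕ y) % b p) ⟧) ≡ share v p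
  test-count v p s = trans (sum-rotate (b p) (λ y → ⟦ test v p y ⟧) s) unrotated
    where
    unrotated : sum {b p} (λ y → ⟦ test v p (toℕ y) ⟧) ≡ share v p
    unrotated with p ≡ᵇ v
    ... | true = count-< (a p) (κ p)
    ... | false with (p <ᵇ v) ∧ A p v
    ...   | true = count-≮ (a p) (κ p)
    ...   | false = trans (sum-const (b p) 1) (*-identityʳ (b p))

  near-self : ∀ p → near p p ≡ true
  near-self p rewrite ≡ᵇ-refl p = refl

  near-later : ∀ {p u} → p < u → A p u ≡ true → near p u ≡ true
  near-later {p} {u} p<u e rewrite <ᵇ-true p<u | e with p ≡ᵇ u
  ... | true = refl
  ... | false = refl

  near⁻¹ : ∀ {p u} → near p u ≡ true → p ≡ u ⊎ (p < u × A p u ≡ true)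
  near⁻¹ {p} {u} e with p ≡ᵇ u in eq
  ... | true = inj₁ (≡ᵇ-true⁻¹ eq)
  ... | false with ∧-true e
  ...   | p<u , Apu = inj₂ (<ᵇ-true⁻¹ p<u , Apu)

  -- A view of the three branches of `test`. In the branch `free` nothing about `σ p` has to be
  -- known, which matters because `σ p` may then involve vertices that v does not see.
  data Tested (v p : ℕ) : Set where
    own     : p ≡ v → Tested v p
    earlier : p < v → A p v ≡ true → Tested v p
    free    : (∀ y → test v p y ≡ true) → Tested v p

  tested? : ∀ v p → Tested v p
  tested? v p with p ≡ᵇ v in eq
  ... | true = own (≡ᵇ-true⁻¹ eq)
  ... | false with (p <ᵇ v) ∧ A p v in eq′
  ...   | true = let p<v , Apv = ∧-true eq′ in earlier (<ᵇ-true⁻¹ p<v) Apv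
  ...   | false = free λ y → cong₂ (λ s t → if s then y <ᵇ a p else (if t then not (y <ᵇ a p) else true)) eq eq′

  tested-near : ∀ {v p} → p ≡ v ⊎ (p < v × A p v ≡ true) → near p v ≡ true
  tested-near {p = p} (inj₁ refl) = near-self p
  tested-near (inj₂ (p<v , e)) = near-later p<v e

  -- Every vertex entering a sum that v inspects is v or a neighbour of v: this is where
  -- the elimination order has to be perfect.
  visible : ∀ {v p u} → v < n → u < n → u ≢ v → p ≡ v ⊎ (p < v × A p v ≡ true) → near p u ≡ true → A v u ≡ true
  visible {v} {p} {u} v<n u<n u≢v tested e with tested | near⁻¹ {p} {u} e
  ... | inj₁ p≡v         | inj₁ p≡u = contradiction (trans (sym p≡u) p≡v) u≢v
  ... | inj₁ refl        | inj₂ (_ , e′) = e′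
  ... | inj₂ (_ , e′)    | inj₁ refl = trans (A-sym v p) e′
  ... | inj₂ (p<v , e′) | inj₂ (p<u , e″) = simplicial p<v p<u v<n u<n e′ e″ (u≢v ∘ sym)

  σ-cong : ∀ p {c c′} → (∀ u → near p (toℕ u) ≡ true → c u ≡ c′ u) → σ p c ≡ σ p c′
  σ-cong p {c} {c′} e = sum-cong-≗ {n} pointwise
    where
    pointwise : ∀ u → (if near p (toℕ u) then digit n (c u) p else 0) ≡ (if near p (toℕ u) then digit n (c′ u) p else 0)
    pointwise u with near p (toℕ u) in eq
    ... | true = cong (λ x → digit n x p) (e u eq)
    ... | false = refl

  -- For every p that v tests, the summands of `σ p` come from v itself, where both colourings now
  -- carry x, and from neighbours of v, by `visible`.
  guess-local : Local graph (Π n b) guess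
  guess-local v c c′ agree = tabulate-cong λ x → allBelow-cong n λ p _ → same x p (tested? (toℕ v) p)
    where
    σ-same : ∀ x p → p ≡ toℕ v ⊎ (p < toℕ v × A p (toℕ v) ≡ true) → σ p (recolour c v x) ≡ σ p (recolour c′ v x)
    σ-same x p tested = σ-cong p pointwise
      where
      pointwise : ∀ u → near p (toℕ u) ≡ true → recolour c v x u ≡ recolour c′ v x u
      pointwise u e with u Fin.≟ v
      ... | yes refl = trans (updateAt-updates v c) (sym (updateAt-updates v c′))
      ... | no u≢v = trans (updateAt-minimal u v c u≢v)
              (trans (agree u (visible (toℕ<n v) (toℕ<n u) (u≢v ∘ toℕ-injective) tested e))
                     (sym (updateAt-minimal u v c′ u≢v)))
    same : ∀ x p → Tested (toℕ v) p →
           test (toℕ v) p (σ p (recolour c v x) % b p) ≡ test (toℕ v) p (σ p (recolour c′ v x) % b p)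
    same x p (own e) = cong (λ s → test (toℕ v) p (s % b p)) (σ-same x p (inj₁ e))
    same x p (earlier p<v e) = cong (λ s → test (toℕ v) p (s % b p)) (σ-same x p (inj₂ (p<v , e)))
    same x p (free t) = trans (t (σ p (recolour c v x) % b p)) (sym (t (σ p (recolour c′ v x) % b p)))

  -- The vertex v enters `σ p` once, so its digit splits off and leaves a constant independent of x.
  -- This turns the test into a rotated condition on one digit.
  σ-recolour : ∀ c v x p → near p (toℕ v) ≡ true →
    σ p (recolour c v x) ≡ sum (λ u → if near p (toℕ u) then updateAt (λ w → digit n (c w) p) v (const 0) u else 0) + digit n x p
  σ-recolour c v x p e = begin
    sum f              ≡⟨ +-identityʳ (sum f) ⟨
    sum f + 0          ≡⟨ cong (sum f +_) (trans (if-true e) (updateAt-updates v (λ w → digit n (c w) p))) ⟨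
    sum f + g v        ≡⟨ sum-update v others ⟩
    sum g + f v        ≡⟨ cong (sum g +_) (trans (if-true e)
                                               (cong (λ y → digit n y p) (updateAt-updates v c))) ⟩
    sum g + digit n x p ∎
    where
    open ≡-Reasoning
    f g : Fin n → ℕ
    f u = if near p (toℕ u) then digit n (recolour c v x u) p else 0
    g u = if near p (toℕ u) then updateAt (λ w → digit n (c w) p) v (const 0) u else 0
    others : ∀ u → u ≢ v → f u ≡ g u
    others u u≢v = cong (λ y → if near p (toℕ u) then y else 0)
      (trans (cong (λ y → digit n y p) (updateAt-minimal u v c u≢v)) (sym (updateAt-minimal u v (λ w → digit n (c w) p) u≢v)))

  -- The tests at different p constrain different digits of x, each by a rotated condition, so
  -- `count-box` multiplies the counts.
  guess-size : ∀ v c → ∣ guess v c ∣ ≡ Π n (share (toℕ v))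
  guess-size v c = begin
    ∣ guess v c ∣
      ≡⟨ ∣tabulate∣ {Π n b} _ ⟩
    sum {Π n b} (λ x → ⟦ right v (recolour c v x) ⟧)
      ≡⟨ sum-cong-≗ {Π n b} (λ x → cong ⟦_⟧ (allBelow-cong n λ p _ → separate x p (tested? (toℕ v) p))) ⟩
    sum {Π n b} (λ x → ⟦ allBelow n (λ p → test (toℕ v) p ((rest p + digit n x p) % b p)) ⟧)
      ≡⟨ count-box (λ p y → test (toℕ v) p ((rest p + y) % b p)) (share (toℕ v)) (λ p → test-count (toℕ v) p (rest p)) n ⟩
    Π n (share (toℕ v)) ∎
    where
    open ≡-Reasoning
    rest : ℕ → ℕ
    rest p = sum (λ u → if near p (toℕ u) then updateAt (λ w → digit n (c w) p) v (const 0) u else 0)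
    σ-rest : ∀ x p → near p (toℕ v) ≡ true →
      test (toℕ v) p (σ p (recolour c v x) % b p) ≡ test (toℕ v) p ((rest p + digit n x p) % b p)
    σ-rest x p e = cong (λ s → test (toℕ v) p (s % b p)) (σ-recolour c v x p e)
    separate : ∀ x p → Tested (toℕ v) p →
      test (toℕ v) p (σ p (recolour c v x) % b p) ≡ test (toℕ v) p ((rest p + digit n x p) % b p)
    separate x p (own e) = σ-rest x p (tested-near (inj₁ e))
    separate x p (earlier p<v e) = σ-rest x p (tested-near (inj₂ (p<v , e)))
    separate x p (free t) = trans (t (σ p (recolour c v x) % b p)) (sym (t ((rest p + digit n x p) % b p)))

  share-own : ∀ v → share v v ≡ a v
  share-own v rewrite ≡ᵇ-refl v = refl

  share-earlier : ∀ {v p} → p < v → share v p ≡ (if A p v then κ p else b p)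
  share-earlier {v} {p} p<v rewrite ≡ᵇ-false (<⇒≢ p<v) | <ᵇ-true p<v = refl

  share-later : ∀ {v p} → v < p → share v p ≡ b p
  share-later {v} {p} v<p rewrite ≡ᵇ-false (<⇒≢ v<p ∘ sym) | <ᵇ-false (<⇒≤ v<p) = refl

  -- For the digits up to v this is `critical`; each later digit is untested and multiplies both
  -- sides by `b p`. Hence all vertices make equally many guesses.
  share-total : ∀ {v} → v < n → h * Π n (share v) ≡ Π n b
  share-total {v} v<n = beyond n v<n
    where
    open ≡-Reasoning
    upTo : h * Π (suc v) (share v) ≡ Π (suc v) b
    upTo = begin
      h * (Π v (share v) * share v v)
        ≡⟨ cong₂ (λ x y → h * (x * y)) (Π-cong v (λ p p<v → share-earlier p<v)) (share-own v) ⟩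
      h * (Π v (λ p → if A p v then κ p else b p) * a v)
        ≡⟨ rearrange h (Π v (λ p → if A p v then κ p else b p)) (a v) ⟩
      h * a v * Π v (λ p → if A p v then κ p else b p)
        ≡⟨ critical v<n ⟩
      b v * Π v b
        ≡⟨ *-comm (b v) _ ⟩
      Π v b * b v ∎
      where
      rearrange : ∀ x y z → x * (y * z) ≡ x * z * y
      rearrange = solve-∀
    beyond : ∀ t → v < t → h * Π t (share v) ≡ Π t b
    beyond (suc t) v<1+t with m≤n⇒m<n∨m≡n (≤-pred v<1+t)
    ... | inj₂ refl = upTo
    ... | inj₁ v<t = trans (sym (*-assoc h (Π t (share v)) (share v t))) (cong₂ _*_ (beyond t v<t) (share-later v<t))

  b-positive : ∀ p → 0 < b p
  b-positive p = s≤s z≤n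

  winning : 0 < h → ∃[ g ] (0 < g × h * g ≡ Π n b × Winning graph (Π n b) g)
  winning h>0 with final
  ... | z , z<n , κz≡0 = g , g>0 , share-total z<n , guess , guess-local , size , wins
    where
    g : ℕ
    -- Every vertex gives the same value, by `share-total`; z serves because it is at hand.
    g = Π n (share z)
    instance
      h≢0 : NonZero h
      h≢0 = >-nonZero h>0
    g>0 : 0 < g
    g>0 = n≢0⇒n>0 λ g≡0 → <⇒≢ (Π-positive n b-positive)
      (trans (sym (*-zeroʳ h)) (trans (cong (h *_) (sym g≡0)) (share-total z<n)))
    size : HasGuesses graph (Π n b) g guess
    size v c = trans (guess-size v c) (*-cancelˡ-≡ _ _ h (trans (share-total (toℕ<n v)) (sym (share-total z<n))))
    module _ (c : Fin n → Colour) where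
      hit : ℕ → Bool
      hit p = σ p c % b p <ᵇ a p
      -- Weight 1 means that `a z` is the whole modulus `b z`, so every residue is a hit.
      hit-z : hit z ≡ true
      hit-z = <ᵇ-true (subst (σ z c % b z <_) (trans (cong (a z +_) κz≡0) (+-identityʳ (a z))) (m%n<n (σ z c) (b z)))
      first : ∃[ v ] (v < n × hit v ≡ true × (∀ p → p < v → hit p ≡ false))
      first with least hit n
      ... | inj₂ found = found
      ... | inj₁ none = contradiction (trans (sym hit-z) (none z z<n)) λ ()
      wins : ∃[ v ] (c v ∈ guess v c)
      wins with first
      ... | v , v<n , hit-v , misses = w , lookup⇒[]= (c w) _ (trans (lookup∘tabulate _ (c w)) correct)
        where
        w : Fin n
        w = fromℕ< v<n
        w≡v : toℕ w ≡ v
        w≡v = toℕ-fromℕ< v<n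
        unchanged : ∀ u → recolour c w (c w) u ≡ c u
        unchanged u with u Fin.≟ w
        ... | yes refl = updateAt-updates w c
        ... | no u≢w = updateAt-minimal u w c u≢w
        passes : ∀ p → Tested v p → test v p (σ p c % b p) ≡ true
        passes p (own refl) rewrite ≡ᵇ-refl v = hit-v
        passes p (earlier p<v e) rewrite ≡ᵇ-false (<⇒≢ p<v) | <ᵇ-true p<v | e = cong not (misses p p<v)
        passes p (free t) = t (σ p c % b p)
        correct : right w (recolour c w (c w)) ≡ true
        correct = allBelow-true n λ p _ → trans
          (cong₂ (λ i s → test i p (s % b p)) w≡v (σ-cong p (λ u _ → unchanged u)))
          (passes p (tested? v p))

-- Sums over all colourings, and indicators

sum-positive⁻¹ : ∀ {n} (f : Fin n → ℕ) → 0 < sum f → ∃[ i ] 0 < f i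
sum-positive⁻¹ {suc n} f pos with f zero in eq
... | suc k = zero , subst (0 <_) (sym eq) (s≤s z≤n)
... | zero with sum-positive⁻¹ (f ∘ suc) pos
...   | i , fi>0 = suc i , fi>0

∣∣≡sum : ∀ {n} (p : Subset n) → ∣ p ∣ ≡ sum (⟦_⟧ ∘ lookup p)
∣∣≡sum p = trans (cong ∣_∣ (sym (tabulate∘lookup p))) (∣tabulate∣ (lookup p))

module VecSum (M : ℕ) (M>0 : 0 < M) where

  -- Colourings are vectors here, so that summing over them is a recursion on coordinates.
  ∑ᵛ : ∀ n → (Vec (Fin M) n → ℕ) → ℕ
  ∑ᵛ zero F = F []
  ∑ᵛ (suc n) F = sum (λ a → ∑ᵛ n (λ c → F (a ∷ c)))

  ∑ᵛ-mono : ∀ n {F G : Vec (Fin M) n → ℕ} → (∀ c → F c ≤ G c) → ∑ᵛ n F ≤ ∑ᵛ n G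
  ∑ᵛ-mono zero F≤G = F≤G []
  ∑ᵛ-mono (suc n) F≤G = sum-mono λ a → ∑ᵛ-mono n λ c → F≤G (a ∷ c)

  ∑ᵛ-+ : ∀ n (F G : Vec (Fin M) n → ℕ) → ∑ᵛ n (λ c → F c + G c) ≡ ∑ᵛ n F + ∑ᵛ n G
  ∑ᵛ-+ zero F G = refl
  ∑ᵛ-+ (suc n) F G = trans (sum-cong-≗ {M} λ a → ∑ᵛ-+ n _ _) (∑-distrib-+ {M} _ _)

  ∑ᵛ-* : ∀ n k (F : Vec (Fin M) n → ℕ) → ∑ᵛ n (λ c → k * F c) ≡ k * ∑ᵛ n F
  ∑ᵛ-* zero k F = refl
  ∑ᵛ-* (suc n) k F = trans (sum-cong-≗ {M} λ a → ∑ᵛ-* n k _) (sym (*-distribˡ-sum {M} k _))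

  ∑ᵛ-sum : ∀ n (F : Fin M → Vec (Fin M) n → ℕ) → sum (λ a → ∑ᵛ n (F a)) ≡ ∑ᵛ n (λ c → sum (λ a → F a c))
  ∑ᵛ-sum zero F = refl
  ∑ᵛ-sum (suc n) F = trans (∑-comm {M} {M} _) (sum-cong-≗ {M} λ a → ∑ᵛ-sum n (λ a′ c → F a′ (a ∷ c)))

  -- Varying only the colour of v partitions the colourings into fibres, and it suffices to compare
  -- the two sums on each fibre.
  ∑ᵛ-resample : ∀ {n} (v : Fin n) {F G : Vec (Fin M) n → ℕ} →
    (∀ c → sum (λ a → F (c [ v ]≔ a)) ≤ sum (λ a → G (c [ v ]≔ a))) → ∑ᵛ n F ≤ ∑ᵛ n G
  ∑ᵛ-resample {suc n} zero F≤G = subst₂ _≤_ (sym (∑ᵛ-sum n _)) (sym (∑ᵛ-sum n _))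
    -- The head is a placeholder that the update at `zero` overwrites.
    (∑ᵛ-mono n λ c → F≤G (fromℕ< M>0 ∷ c))
  ∑ᵛ-resample (suc v) F≤G = sum-mono λ a → ∑ᵛ-resample v λ c → F≤G (a ∷ c)

  ∑ᵛ-positive : ∀ n {F : Vec (Fin M) n → ℕ} → (∀ c → 0 < F c) → 0 < ∑ᵛ n F
  ∑ᵛ-positive zero pos = pos []
  ∑ᵛ-positive (suc n) pos = <-≤-trans M>0 (≤-trans
    (≤-reflexive (sym (trans (sum-const M 1) (*-identityʳ M))))
    (sum-mono {M} λ a → ∑ᵛ-positive n λ c → pos (a ∷ c)))

  ∑ᵛ-positive⁻¹ : ∀ n (F : Vec (Fin M) n → ℕ) → 0 < ∑ᵛ n F → ∃[ c ] 0 < F c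
  ∑ᵛ-positive⁻¹ zero F pos = [] , pos
  ∑ᵛ-positive⁻¹ (suc n) F pos with sum-positive⁻¹ {M} _ pos
  ... | a , pos′ with ∑ᵛ-positive⁻¹ n _ pos′
  ...   | c , Fc>0 = a ∷ c , Fc>0

𝟙 : ∀ {P : Set} → Dec P → ℕ
𝟙 d = ⟦ does d ⟧

𝟙-yes : ∀ {P : Set} (d : Dec P) → P → 𝟙 d ≡ 1
𝟙-yes (yes _) _ = refl
𝟙-yes (no ¬p) p = contradiction p ¬p

𝟙-≤ : ∀ {P : Set} (d : Dec P) {k} → (P → 1 ≤ k) → 𝟙 d ≤ k
𝟙-≤ (yes p) f = f p
𝟙-≤ (no _) f = z≤n

𝟙-mono : ∀ {P Q : Set} (d : Dec P) (e : Dec Q) → (P → Q) → 𝟙 d ≤ 𝟙 e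
𝟙-mono d e f = 𝟙-≤ d λ p → ≤-reflexive (sym (𝟙-yes e (f p)))

𝟙-positive⁻¹ : ∀ {P : Set} (d : Dec P) → 0 < 𝟙 d → P
𝟙-positive⁻¹ (yes p) _ = p

-- The losing side: a local lemma along the elimination order

module _ {h n : ℕ} (W : CriticalWeights h n) where
  open CriticalWeights W

  -- Over the denominator `Π t b` this is the product of 1 - x_p over the neighbours p < t of v.
  residual : ℕ → ℕ → ℕ
  residual t v = Π t (λ p → if A p v then κ p else b p)

  -- The right-hand side of `critical` is positive, so no factor on the left vanishes. In particular
  -- a vertex of weight 1 has no later neighbour.
  residual-positive : ∀ {v} → v < n → 0 < a v * residual v v
  residual-positive {v} v<n = n≢0⇒n>0 λ z → <⇒≢ (*-mono-< (s≤s {n = α v + κ v} z≤n) (Π-positive v λ p → s≤s z≤n))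
    (trans (sym (*-zeroʳ h)) (trans (cong (h *_) (sym z)) (trans (sym (*-assoc h (a v) _)) (critical v<n))))

  module Losing {M g : ℕ} (hg<M : h * g < M) (f : Strategy graph M)
                (local : Local graph M f) (size : HasGuesses graph M g f) where

    open VecSum M (≤-<-trans z≤n hg<M)

    Missed : (Fin n → Bool) → Vec (Fin M) n → Set
    Missed S c = ∀ u → S u ≡ true → lookup c u ∉ f u (lookup c)

    missed? : ∀ S c → Dec (Missed S c)
    missed? S c = Finₚ.all? λ u → (S u Bool.≟ true) →-dec ¬? (lookup c u ∈? f u (lookup c))

    -- Divided by the number of all colourings, this is the probability that everyone in S guesses
    -- wrong.
    N : (Fin n → Bool) → ℕ
    N S = ∑ᵛ n (λ c → 𝟙 (missed? S c))

    guess-resample : ∀ {u v} (c : Vec (Fin M) n) x → A (toℕ u) (toℕ v) ≡ false →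
                     f u (lookup (c [ v ]≔ x)) ≡ f u (lookup c)
    guess-resample {u} {v} c x far = local u _ _ λ w near → lookup∘update′ (λ { refl → true≢false (trans (sym near) far) }) c x
      where
      true≢false : true ≢ false
      true≢false ()

    missed-resample : ∀ {T v} (c : Vec (Fin M) n) x → (∀ u → T u ≡ true → u ≢ v × A (toℕ v) (toℕ u) ≡ false) →
                      𝟙 (missed? T (c [ v ]≔ x)) ≡ 𝟙 (missed? T c)
    missed-resample {T} {v} c x far = ≤-antisym
      (𝟙-mono (missed? T (c [ v ]≔ x)) (missed? T c) λ miss u Tu → subst₂ _∉_ (same-colour u Tu) (same-guess u Tu) (miss u Tu))
      (𝟙-mono (missed? T c) (missed? T (c [ v ]≔ x)) λ miss u Tu → subst₂ _∉_ (sym (same-colour u Tu)) (sym (same-guess u Tu)) (miss u Tu))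
      where
      same-colour : ∀ u → T u ≡ true → lookup (c [ v ]≔ x) u ≡ lookup c u
      same-colour u Tu = lookup∘update′ (proj₁ (far u Tu)) c x
      same-guess : ∀ u → T u ≡ true → f u (lookup (c [ v ]≔ x)) ≡ f u (lookup c)
      same-guess u Tu = guess-resample c x (trans (A-sym (toℕ u) (toℕ v)) (proj₂ (far u Tu)))

    -- Given the colours of the other vertices, v guesses right for exactly g of its M
    -- colours, and the event that T is missed does not depend on the colour of v.
    resample-bound : ∀ (v : Fin n) S S′ T → (∀ u → S′ u ≡ true → S u ≡ true ⊎ u ≡ v) →
      (∀ u → T u ≡ true → S u ≡ true × u ≢ v × A (toℕ v) (toℕ u) ≡ false) →
      M * N S ≤ M * N S′ + g * N T
    resample-bound v S S′ T S′⊆ T⊆ = subst₂ _≤_ (∑ᵛ-* n M (λ c → 𝟙 (missed? S c)))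
      (trans (∑ᵛ-+ n (λ c → M * 𝟙 (missed? S′ c)) (λ c → g * 𝟙 (missed? T c))) (cong₂ _+_ (∑ᵛ-* n M (λ c → 𝟙 (missed? S′ c))) (∑ᵛ-* n g (λ c → 𝟙 (missed? T c)))))
      (∑ᵛ-resample v fibre)
      where
      open ≤-Reasoning
      fibre : ∀ c → sum (λ x → M * 𝟙 (missed? S (c [ v ]≔ x)))
                  ≤ sum (λ x → M * 𝟙 (missed? S′ (c [ v ]≔ x)) + g * 𝟙 (missed? T (c [ v ]≔ x)))
      fibre c = begin
        sum (λ x → M * s x)                          ≡⟨ *-distribˡ-sum M s ⟨
        M * sum s                                    ≤⟨ *-monoʳ-≤ M (sum-mono pointwise) ⟩
        M * sum (λ x → s′ x + τ * ⟦ lookup G x ⟧)    ≡⟨ cong (M *_) (∑-distrib-+ s′ (λ x → τ * ⟦ lookup G x ⟧)) ⟩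
        M * (sum s′ + sum (λ x → τ * ⟦ lookup G x ⟧)) ≡⟨ cong (λ k → M * (sum s′ + k)) (*-distribˡ-sum τ (⟦_⟧ ∘ lookup G)) ⟨
        M * (sum s′ + τ * sum (⟦_⟧ ∘ lookup G))      ≡⟨ cong (λ k → M * (sum s′ + τ * k)) (trans (sym (∣∣≡sum G)) (size v (lookup c))) ⟩
        M * (sum s′ + τ * g)                         ≡⟨ regroup M (sum s′) τ g ⟩
        M * sum s′ + M * (g * τ)                     ≡⟨ cong₂ _+_ (*-distribˡ-sum M s′) (sym (sum-const M (g * τ))) ⟩
        sum (λ x → M * s′ x) + sum {M} (λ _ → g * τ) ≡⟨ ∑-distrib-+ (λ x → M * s′ x) _ ⟨
        sum (λ x → M * s′ x + g * τ)
          ≡⟨ sum-cong-≗ (λ x → cong (λ k → M * s′ x + g * k) (missed-resample c x (λ u Tu → proj₂ (T⊆ u Tu)))) ⟨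
        sum (λ x → M * s′ x + g * 𝟙 (missed? T (c [ v ]≔ x))) ∎
        where
        s s′ : Fin M → ℕ
        s x = 𝟙 (missed? S (c [ v ]≔ x))
        s′ x = 𝟙 (missed? S′ (c [ v ]≔ x))
        τ : ℕ
        τ = 𝟙 (missed? T c)
        G : Subset M
        G = f v (lookup c)
        regroup : ∀ x y z w → x * (y + z * w) ≡ x * y + x * (w * z)
        regroup = solve-∀
        own-guess : ∀ x → f v (lookup (c [ v ]≔ x)) ≡ G
        own-guess x = guess-resample c x (A-irrefl (toℕ v))
        -- If S is missed, either v is right, and T is missed as a part of S, or v is wrong too and
        -- S′ is missed.
        pointwise : ∀ x → s x ≤ s′ x + τ * ⟦ lookup G x ⟧
        pointwise x = 𝟙-≤ (missed? S (c [ v ]≔ x)) someone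
          where
          someone : Missed S (c [ v ]≔ x) → 1 ≤ s′ x + τ * ⟦ lookup G x ⟧
          someone miss with lookup G x in eq
          ... | true = ≤-trans (≤-reflexive (sym (trans (*-identityʳ τ) τ≡1))) (m≤n+m (τ * 1) (s′ x))
            where
            τ≡1 : τ ≡ 1
            τ≡1 = trans (sym (missed-resample c x (λ u Tu → proj₂ (T⊆ u Tu))))
                        (𝟙-yes (missed? T (c [ v ]≔ x)) λ u Tu → miss u (proj₁ (T⊆ u Tu)))
          ... | false = ≤-trans (≤-reflexive (sym (𝟙-yes (missed? S′ (c [ v ]≔ x)) miss′))) (m≤m+n (s′ x) _)
            where
            miss′ : Missed S′ (c [ v ]≔ x)
            miss′ u S′u with S′⊆ u S′u
            ... | inj₁ Su = miss u Su
            ... | inj₂ refl = λ hit → contradiction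
              (trans (sym eq) ([]=⇒lookup (subst₂ _∈_ (lookup∘update v c x) (own-guess x) hit))) λ ()

    -- In probabilities: g / M divided by ∏ (1 - x_p) over the earlier neighbours of v is less than
    -- x_v. This is `critical` combined with `h * g < M`.
    weight-bound : ∀ {v} → v < n → g * Π v b * b v < M * residual v v * a v
    weight-bound {v} v<n = begin-strict
      g * Π v b * b v               ≡⟨ trans (*-assoc g _ _) (cong (g *_) (*-comm (Π v b) (b v))) ⟩
      g * (b v * Π v b)             ≡⟨ cong (g *_) (critical v<n) ⟨
      g * (h * a v * residual v v)  ≡⟨ regroup g h (a v) (residual v v) ⟩
      h * g * (a v * residual v v)  <⟨ *-monoˡ-< _ {{>-nonZero (residual-positive v<n)}} hg<M ⟩
      M * (a v * residual v v)      ≡⟨ regroup′ M (a v) (residual v v) ⟩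
      M * residual v v * a v        ∎
      where
      open ≤-Reasoning
      regroup : ∀ x y z w → x * (y * z * w) ≡ y * x * (z * w)
      regroup = solve-∀
      regroup′ : ∀ x y z → x * (y * z) ≡ x * z * y
      regroup′ = solve-∀

    -- After conditioning on the vertices below t being wrong, v is right with probability at most
    -- g / M times the product of b p / κ p over the neighbours p < t of v.
    Eliminated : ℕ → Set
    Eliminated t = ∀ (v : Fin n) → t ≤ toℕ v → ∀ S S′ T → (∀ u → S′ u ≡ true → S u ≡ true ⊎ u ≡ v) →
      (∀ u → T u ≡ true → S u ≡ true × (toℕ u < t ⊎ (u ≢ v × A (toℕ v) (toℕ u) ≡ false))) →
      M * residual t (toℕ v) * N S ≤ M * residual t (toℕ v) * N S′ + g * Π t b * N T

    -- The passage from t to t + 1: multiply by the new residual factor w and trade `w * Z` for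
    -- `r * Z′`, where r is the new denominator `b t`.
    scale : ∀ {x y z u w r s X Y Z Z′} → x * y * X ≤ x * y * Y + z * u * Z → w * Z ≤ r * Z′ → s ≡ w →
            x * (y * s) * X ≤ x * (y * s) * Y + z * (u * r) * Z′
    scale {x} {y} {z} {u} {w} {r} {_} {X} {Y} {Z} {Z′} le le′ refl = begin
      x * (y * w) * X                    ≡⟨ regroup x y w X ⟩
      w * (x * y * X)                    ≤⟨ *-monoʳ-≤ w le ⟩
      w * (x * y * Y + z * u * Z)        ≡⟨ regroup′ x y w Y z u Z ⟩
      x * (y * w) * Y + z * u * (w * Z)  ≤⟨ +-monoʳ-≤ _ (*-monoʳ-≤ (z * u) le′) ⟩
      x * (y * w) * Y + z * u * (r * Z′) ≡⟨ cong (x * (y * w) * Y +_) (regroup″ z u r Z′) ⟩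
      x * (y * w) * Y + z * (u * r) * Z′ ∎
      where
      open ≤-Reasoning
      regroup : ∀ x y w X → x * (y * w) * X ≡ w * (x * y * X)
      regroup = solve-∀
      regroup′ : ∀ x y w Y z u Z → w * (x * y * Y + z * u * Z) ≡ x * (y * w) * Y + z * u * (w * Z)
      regroup′ = solve-∀
      regroup″ : ∀ z u r Z → z * u * (r * Z) ≡ z * (u * r) * Z
      regroup″ = solve-∀

    -- If the share of X lost in Y is at most z / x, and this is below the weight a / (a + k), then
    -- at least the share k / (a + k) survives.
    absorb : ∀ {x z a k X Y} → x * X ≤ x * Y + z * X → z * (a + k) < x * a → k * X ≤ (a + k) * Y
    absorb {x} {z} {a} {k} {X} {Y} le lt = *-cancelˡ-≤ x {{>-nonZero x>0}} (+-cancelʳ-≤ (x * a * X) _ _ (begin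
      x * (k * X) + x * a * X                ≡⟨ regroup x a k X ⟩
      (a + k) * (x * X)                      ≤⟨ *-monoʳ-≤ (a + k) le ⟩
      (a + k) * (x * Y + z * X)              ≡⟨ regroup′ x a k z X Y ⟩
      x * ((a + k) * Y) + z * (a + k) * X    ≤⟨ +-monoʳ-≤ _ (*-monoˡ-≤ X (<⇒≤ lt)) ⟩
      x * ((a + k) * Y) + x * a * X          ∎))
      where
      open ≤-Reasoning
      x>0 : 0 < x
      x>0 = n≢0⇒n>0 λ { refl → contradiction lt λ () }
      regroup : ∀ x a k X → x * (k * X) + x * a * X ≡ (a + k) * (x * X)
      regroup = solve-∀
      regroup′ : ∀ x a k z X Y → (a + k) * (x * Y + z * X) ≡ x * ((a + k) * Y) + z * (a + k) * X
      regroup′ = solve-∀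

    -- Induction on t. If t is not adjacent to v, it counts among the far vertices and the
    -- hypothesis for t applies. Otherwise t is removed from T, the hypothesis is used for v, and a
    -- second use, for the vertex t itself, restores t at the cost of the factor `b t` / `κ t`.
    eliminated : ∀ t → Eliminated t
    eliminated zero v _ S S′ T S′⊆ T⊆ =
      subst₂ _≤_ (cong (_* N S) (sym (*-identityʳ M)))
        (cong₂ _+_ (cong (_* N S′) (sym (*-identityʳ M))) (cong (_* N T) (sym (*-identityʳ g))))
        (resample-bound v S S′ T S′⊆ λ u Tu → proj₁ (T⊆ u Tu) , [ (λ ()) , (λ far → far) ]′ (proj₂ (T⊆ u Tu)))
    eliminated (suc t) v t<v S S′ T S′⊆ T⊆ with A t (toℕ v) in adjacent
    ... | false = scale {x = M} {z = g} {w = b t}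
            (eliminated t v (<⇒≤ t<v) S S′ T S′⊆ λ u Tu → proj₁ (T⊆ u Tu) , far u (proj₂ (T⊆ u Tu)))
            ≤-refl refl
      where
      far : ∀ u → toℕ u < suc t ⊎ (u ≢ v × A (toℕ v) (toℕ u) ≡ false) → toℕ u < t ⊎ (u ≢ v × A (toℕ v) (toℕ u) ≡ false)
      far u (inj₂ p) = inj₂ p
      far u (inj₁ u<1+t) with m≤n⇒m<n∨m≡n (≤-pred u<1+t)
      ... | inj₁ u<t = inj₁ u<t
      ... | inj₂ u≡t = inj₂ ((λ { refl → <⇒≢ t<v (sym u≡t) }) , trans (A-sym (toℕ v) (toℕ u)) (trans (cong (λ i → A i (toℕ v)) u≡t) adjacent))
    ... | true = scale {x = M} {z = g} {w = κ t} {r = b t}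
            (eliminated t v (<⇒≤ t<v) S S′ T₀ S′⊆ λ u T₀u → proj₁ (T⊆ u (T₀⊆T u T₀u)) , strictly-earlier u T₀u (proj₂ (T⊆ u (T₀⊆T u T₀u))))
            (absorb {x = M * residual t t} {z = g * Π t b} {a = a t}
              (subst (λ i → M * residual t i * N T₀ ≤ M * residual t i * N T + g * Π t b * N T₀) w≡t
                (eliminated t w (≤-reflexive (sym w≡t)) T₀ T T₀ T⊆T₀+w λ u T₀u → T₀u , separated u T₀u))
              (weight-bound t<n))
            refl
      where
      t<n : t < n
      t<n = <-trans t<v (toℕ<n v)
      w : Fin n
      w = fromℕ< t<n
      w≡t : toℕ w ≡ t
      w≡t = toℕ-fromℕ< t<n
      T₀ : Fin n → Bool
      T₀ u = T u ∧ not (does (u Fin.≟ w))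
      T₀⊆T : ∀ u → T₀ u ≡ true → T u ≡ true
      T₀⊆T u T₀u = proj₁ (∧-true T₀u)
      T₀≢t : ∀ u → T₀ u ≡ true → toℕ u ≢ t
      T₀≢t u T₀u u≡t with u Fin.≟ w | proj₂ (∧-true {T u} T₀u)
      ... | no u≢w | _ = u≢w (toℕ-injective (trans u≡t (sym w≡t)))
      T⊆T₀+w : ∀ u → T u ≡ true → T₀ u ≡ true ⊎ u ≡ w
      T⊆T₀+w u Tu with u Fin.≟ w
      ... | yes u≡w = inj₂ u≡w
      ... | no _ = inj₁ (cong (_∧ true) Tu)
      strictly-earlier : ∀ u → T₀ u ≡ true → toℕ u < suc t ⊎ (u ≢ v × A (toℕ v) (toℕ u) ≡ false) → toℕ u < t ⊎ (u ≢ v × A (toℕ v) (toℕ u) ≡ false)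
      strictly-earlier u T₀u (inj₂ p) = inj₂ p
      strictly-earlier u T₀u (inj₁ u<1+t) = inj₁ (≤∧≢⇒< (≤-pred u<1+t) (T₀≢t u T₀u))
      -- A vertex u > t of T₀ is not adjacent to v. It cannot be adjacent to t either, since two
      -- later neighbours of t are adjacent by `simplicial`.
      separated : ∀ u → T₀ u ≡ true → toℕ u < t ⊎ (u ≢ w × A (toℕ w) (toℕ u) ≡ false)
      separated u T₀u with <-cmp (toℕ u) t
      ... | tri< u<t _ _ = inj₁ u<t
      ... | tri≈ _ u≡t _ = contradiction u≡t (T₀≢t u T₀u)
      ... | tri> _ _ t<u with strictly-earlier u T₀u (proj₂ (T⊆ u (T₀⊆T u T₀u)))
      ...   | inj₁ u<t = contradiction u<t (<-asym t<u)
      ...   | inj₂ (u≢v , far) with A (toℕ w) (toℕ u) in eq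
      ...     | false = inj₂ ((λ { refl → T₀≢t u T₀u w≡t }) , refl)
      ...     | true = contradiction
        (trans (sym (simplicial t<v t<u (toℕ<n v) (toℕ<n u) adjacent (trans (cong (λ i → A i (toℕ u)) (sym w≡t)) eq)
                      (u≢v ∘ sym ∘ toℕ-injective))) far) λ ()

    below : ℕ → Fin n → Bool
    below t u = toℕ u <ᵇ t

    -- Given that all vertices below t are wrong, t is right with probability less than its weight,
    -- hence less than 1, so it can be wrong as well.
    all-missed-below : ∀ t → t ≤ n → 0 < N (below t)
    all-missed-below zero _ = ∑ᵛ-positive n λ c → subst (0 <_) (sym (𝟙-yes (missed? (below 0) c) λ u ())) (s≤s z≤n)
    all-missed-below (suc t) t<n = n≢0⇒n>0 λ none → contradiction
      (*-cancelʳ-≤ (M * residual t t) (g * Π t b) (N (below t)) {{>-nonZero (all-missed-below t (<⇒≤ t<n))}} (begin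
        M * residual t t * N (below t)
          ≤⟨ subst (λ i → M * residual t i * N (below t) ≤ M * residual t i * N (below (suc t)) + g * Π t b * N (below t)) w≡t
               (eliminated t w (≤-reflexive (sym w≡t)) (below t) (below (suc t)) (below t) split λ u u<t → u<t , inj₁ (<ᵇ-true⁻¹ u<t)) ⟩
        M * residual t t * N (below (suc t)) + g * Π t b * N (below t)
          ≡⟨ cong (_+ g * Π t b * N (below t)) (trans (cong (M * residual t t *_) none) (*-zeroʳ (M * residual t t))) ⟩
        g * Π t b * N (below t) ∎))
      (<⇒≱ (*-cancelʳ-< (b t) (g * Π t b) (M * residual t t) (<-≤-trans (weight-bound t<n) (*-monoʳ-≤ (M * residual t t) (m≤m+n (a t) (κ t))))))
      where
      open ≤-Reasoning
      w : Fin n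
      w = fromℕ< t<n
      w≡t : toℕ w ≡ t
      w≡t = toℕ-fromℕ< t<n
      split : ∀ u → below (suc t) u ≡ true → below t u ≡ true ⊎ u ≡ w
      split u u<1+t with m≤n⇒m<n∨m≡n (≤-pred (<ᵇ-true⁻¹ {toℕ u} u<1+t))
      ... | inj₁ u<t = inj₁ (<ᵇ-true u<t)
      ... | inj₂ u≡t = inj₂ (toℕ-injective (trans u≡t (sym w≡t)))

    losing : ∃[ c ] (∀ v → c v ∉ f v c)
    losing with ∑ᵛ-positive⁻¹ n _ (all-missed-below n ≤-refl)
    ... | c , pos = lookup c , λ v → 𝟙-positive⁻¹ (missed? (below n) c) pos v (<ᵇ-true (toℕ<n v))

  fracHatChromaticEq : 0 < h → FracHatChromaticEq graph h
  fracHatChromaticEq h>0 = upper , lower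
    where
    upper : ∀ h′ g → 1 ≤ h′ → 1 ≤ g → Winning graph h′ g → h′ ≤ h * g
    upper h′ g _ _ (f , local , size , wins) = ≮⇒≥ λ hg<h′ →
      let c , misses = Losing.losing hg<h′ f local size
          v , hit = wins c
      in misses v hit
    lower : ∀ p q → 1 ≤ q → p < h * q → ∃[ h′ ] ∃[ g ] (1 ≤ h′ × 1 ≤ g × Winning graph h′ g × p * g < h′ * q)
    -- The winning game has ratio exactly h, so this one game serves every p / q < h.
    lower p q _ p<hq with winning W h>0
    ... | g , g>0 , hg≡H , win = Π n b , g , Π-positive n (λ p → s≤s z≤n) , g>0 , win , (begin-strict
      p * g        <⟨ *-monoˡ-< g {{>-nonZero g>0}} p<hq ⟩
      h * q * g    ≡⟨ regroup h q g ⟩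
      h * g * q    ≡⟨ cong (_* q) hg≡H ⟩
      Π n b * q    ∎)
      where
      open ≤-Reasoning
      regroup : ∀ x y z → x * y * z ≡ x * z * y
      regroup = solve-∀

-- Critical weights from sorted lists of intervals

≤ᵇ-true : ∀ {m n} → m ≤ n → (m ≤ᵇ n) ≡ true
≤ᵇ-true p = Equivalence.to T-≡ (≤⇒≤ᵇ p)

≤ᵇ-true⁻¹ : ∀ {m n} → (m ≤ᵇ n) ≡ true → m ≤ n
≤ᵇ-true⁻¹ {m} {n} e = ≤ᵇ⇒≤ m n (Equivalence.from T-≡ e)

≤ᵇ-false : ∀ {m n} → n < m → (m ≤ᵇ n) ≡ false
≤ᵇ-false {m} {n} n<m with m ≤ᵇ n in e
... | true = contradiction (≤ᵇ-true⁻¹ {m} {n} e) (<⇒≱ n<m)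
... | false = refl

Π-head : ∀ t (f : ℕ → ℕ) → Π (suc t) f ≡ f 0 * Π t (f ∘ suc)
Π-head zero f = trans (*-identityˡ (f 0)) (sym (*-identityʳ (f 0)))
Π-head (suc t) f = trans (cong (_* f (suc t)) (Π-head t f)) (*-assoc (f 0) _ _)

-- Intervals [lo , hi] carrying the weight (1 + α) / (1 + α + κ).
record Interval : Set where
  constructor iv
  field
    lo hi α κ : ℕ

  a b : ℕ
  a = suc α
  b = a + κ

  -- Only the right end is compared: as right ends are sorted, a later interval with left end i
  -- meets this one exactly when `i ≤ hi`.
  kept : ℕ → ℕ
  kept i = if i ≤ᵇ hi then κ else b

open Interval

nth : List Interval → ℕ → Interval
nth [] _ = iv 0 0 0 0
nth (x ∷ xs) zero = x
nth (x ∷ xs) (suc i) = nth xs i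

All-nth : ∀ {P : Interval → Set} {xs} → All P xs → ∀ {i} → i < length xs → P (nth xs i)
All-nth (p ∷ ps) {zero} _ = p
All-nth (p ∷ ps) {suc i} i<n = All-nth ps (≤-pred i<n)

Any-nth : ∀ {P : Interval → Set} {xs} → Any P xs → ∃[ i ] (i < length xs × P (nth xs i))
Any-nth (here p) = 0 , s≤s z≤n , p
Any-nth (there ps) with Any-nth ps
... | i , i<n , p = suc i , s≤s i<n , p

-- D i / E is the product of 1 − weight over the vertices already eliminated whose interval
-- reaches the point i, and ρ is the right end of the last of them.
data Certified (h : ℕ) : ℕ → (ℕ → ℕ) → ℕ → List Interval → Set where
  []  : ∀ {ρ D E} → Certified h ρ D E []
  add : ∀ {ρ D E x xs} → ρ ≤ hi x → lo x ≤ hi x → h * a x * D (lo x) ≡ b x * E →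
        Certified h (hi x) (λ i → D i * kept x i) (E * b x) xs → Certified h ρ D E (x ∷ xs)

module _ {h : ℕ} where

  weaken : ∀ {ρ ρ′ D E xs} → ρ ≤ ρ′ → Certified h ρ′ D E xs → Certified h ρ D E xs
  weaken le [] = []
  weaken le (add p q e c) = add (≤-trans le p) q e c

  lo≤hi : ∀ {ρ D E xs} → Certified h ρ D E xs → All (λ x → lo x ≤ hi x) xs
  lo≤hi [] = []
  lo≤hi (add p q e c) = q ∷ lo≤hi c

  hi-bound : ∀ {ρ D E xs} → Certified h ρ D E xs → All (λ x → ρ ≤ hi x) xs
  hi-bound [] = []
  hi-bound (add p q e c) = p ∷ All.map (≤-trans p) (hi-bound c)

  hi-sorted : ∀ {ρ D E xs} → Certified h ρ D E xs → ∀ {i j} → i < j → j < length xs →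
              hi (nth xs i) ≤ hi (nth xs j)
  hi-sorted (add p q e c) {zero} {suc j} i<j j<n = All-nth (hi-bound c) (≤-pred j<n)
  hi-sorted (add p q e c) {suc i} {suc j} i<j j<n = hi-sorted c (≤-pred i<j) (≤-pred j<n)

  -- General D and E let the induction move the factor of the head into them; D and E equal to 1
  -- give `critical`.
  certified-critical : ∀ {ρ D E xs} → Certified h ρ D E xs → ∀ {v} → v < length xs →
    h * a (nth xs v) * (D (lo (nth xs v)) * Π v (λ p → kept (nth xs p) (lo (nth xs v))))
    ≡ b (nth xs v) * (E * Π v (λ p → b (nth xs p)))
  certified-critical {D = D} {E} {x ∷ xs} (add p q e c) {zero} _ =
    trans (cong (h * a x *_) (*-identityʳ (D (lo x)))) (trans e (cong (b x *_) (sym (*-identityʳ E))))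
  certified-critical {D = D} {E} {x ∷ xs} (add p q e c) {suc v} v<n = begin
    h * a y * (D i * Π (suc v) (λ p → kept (nth (x ∷ xs) p) i))
      ≡⟨ cong (h * a y *_) (trans (cong (D i *_) (Π-head v _)) (sym (*-assoc (D i) (kept x i) _))) ⟩
    h * a y * (D i * kept x i * Π v (λ p → kept (nth xs p) i))
      ≡⟨ certified-critical c (≤-pred v<n) ⟩
    b y * (E * b x * Π v (λ p → b (nth xs p)))
      ≡⟨ cong (b y *_) (trans (cong (E *_) (Π-head v _)) (sym (*-assoc E (b x) _))) ⟨
    b y * (E * Π (suc v) (λ p → b (nth (x ∷ xs) p))) ∎
    where
    open ≡-Reasoning
    y = nth xs v
    i = lo y

meets : Interval → Interval → Bool
meets x y = (lo x ≤ᵇ hi y) ∧ (lo y ≤ᵇ hi x)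

meets-true⁻¹ : ∀ x y → meets x y ≡ true → lo x ≤ hi y × lo y ≤ hi x
meets-true⁻¹ x y e with ∧-true {lo x ≤ᵇ hi y} e
... | p , q = ≤ᵇ-true⁻¹ p , ≤ᵇ-true⁻¹ q

module IntervalGraph (xs : List Interval) where

  Adjacent : ℕ → ℕ → Bool
  Adjacent i j = not (i ≡ᵇ j) ∧ meets (nth xs i) (nth xs j)

  Adjacent-sym : ∀ i j → Adjacent i j ≡ Adjacent j i
  Adjacent-sym i j = cong₂ (λ s t → not s ∧ t) (≡ᵇ-sym i j) (∧-comm (lo (nth xs i) ≤ᵇ hi (nth xs j)) _)
    where
    ≡ᵇ-sym : ∀ i j → (i ≡ᵇ j) ≡ (j ≡ᵇ i)
    ≡ᵇ-sym zero zero = refl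
    ≡ᵇ-sym zero (suc j) = refl
    ≡ᵇ-sym (suc i) zero = refl
    ≡ᵇ-sym (suc i) (suc j) = ≡ᵇ-sym i j

  Adjacent-irrefl : ∀ i → Adjacent i i ≡ false
  Adjacent-irrefl i rewrite ≡ᵇ-refl i = refl

  Adjacent-intro : ∀ {i j} → i ≢ j → lo (nth xs i) ≤ hi (nth xs j) → lo (nth xs j) ≤ hi (nth xs i) → Adjacent i j ≡ true
  Adjacent-intro i≢j p q rewrite ≡ᵇ-false i≢j | ≤ᵇ-true p | ≤ᵇ-true q = refl

  Adjacent-elim : ∀ {i j} → Adjacent i j ≡ true → lo (nth xs i) ≤ hi (nth xs j) × lo (nth xs j) ≤ hi (nth xs i)
  Adjacent-elim {i} {j} e = meets-true⁻¹ (nth xs i) (nth xs j) (proj₂ (∧-true {not (i ≡ᵇ j)} e))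

  criticalWeights : ∀ {h} → Certified h 0 (const 1) 1 xs → Any (λ x → κ x ≡ 0) xs → CriticalWeights h (length xs)
  criticalWeights {h} c last = record
    { A = Adjacent ; A-sym = Adjacent-sym ; A-irrefl = Adjacent-irrefl
    ; α = α ∘ nth xs ; κ = κ ∘ nth xs
    -- Both later neighbours j and k contain the right end of p.
    ; simplicial = λ {p} {j} {k} p<j p<k j<n k<n pj pk j≢k → Adjacent-intro j≢k
        (≤-trans (proj₂ (Adjacent-elim {p} pj)) (hi-sorted c p<k k<n))
        (≤-trans (proj₂ (Adjacent-elim {p} pk)) (hi-sorted c p<j j<n))
    ; critical = λ {v} v<n → trans
        (cong (h * a (nth xs v) *_) (trans (Π-cong v (λ p p<v → kept-adjacent p<v v<n)) (sym (*-identityˡ _))))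
        (trans (certified-critical c v<n) (cong (b (nth xs v) *_) (*-identityˡ _)))
    ; final = Any-nth last }
    where
    kept-adjacent : ∀ {p v} → p < v → v < length xs →
      (if Adjacent p v then κ (nth xs p) else b (nth xs p)) ≡ kept (nth xs p) (lo (nth xs v))
    kept-adjacent {p} {v} p<v v<n
      rewrite ≡ᵇ-false (<⇒≢ p<v)
            | ≤ᵇ-true (≤-trans (All-nth (lo≤hi c) (<-trans p<v v<n)) (hi-sorted c p<v v<n)) = refl

-- Walks and distances in interval graphs

reverse-walk : ∀ (G : Graph) {u v k} → Walk G u v k → Walk G v u k
reverse-walk G {k = k} w = subst (Walk G _ _) (+-identityʳ k) (reverse-onto w here)
  where
  reverse-onto : ∀ {u v x k l} → Walk G u v k → Walk G u x l → Walk G v x (k + l)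
  reverse-onto here acc = acc
  reverse-onto {k = suc k} {l} (step {u} {w} e rest) acc =
    subst (Walk G _ _) (+-suc k l) (reverse-onto rest (step (trans (Graph.sym G w u) e) acc))

module Diameter {h} (xs : List Interval) (c : Certified h 0 (const 1) 1 xs) (last : Any (λ x → κ x ≡ 0) xs) where
  open IntervalGraph xs

  G : Graph
  G = CriticalWeights.graph (criticalWeights c last)

  Vertex : Set
  Vertex = Fin (length xs)

  lo# hi# : Vertex → ℕ
  lo# u = lo (nth xs (toℕ u))
  hi# u = hi (nth xs (toℕ u))

  lo#≤hi# : ∀ u → lo# u ≤ hi# u
  lo#≤hi# u = All-nth (lo≤hi c) (toℕ<n u)

  edge : ∀ {u v} → u ≢ v → lo# u ≤ hi# v → lo# v ≤ hi# u → adj G u v ≡ true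
  edge u≢v = Adjacent-intro (u≢v ∘ toℕ-injective)

  vertex : ∀ {P : Interval → Set} → Any P xs → ∃[ u ] P (nth xs (toℕ {length xs} u))
  vertex {P} q with Any-nth q
  ... | i , i<n , p = fromℕ< i<n , subst (P ∘ nth xs) (sym (toℕ-fromℕ< i<n)) p

  further : ∀ {u w v k} → adj G u w ≡ true → DistLe G w v k → DistLe G u v (suc k)
  further e (m , m≤k , walk) = suc m , s≤s m≤k , step e walk

  -- Of two intervals at least one does not start after the end of the other, and walks can be
  -- reversed, so it suffices to walk to the right.
  symmetrise : ∀ {d} → (∀ u v → lo# u ≤ hi# v → DistLe G u v d) → ∀ u v → DistLe G u v d
  symmetrise forward u v with ≤-total (lo# u) (hi# v)
  ... | inj₁ le = forward u v le
  ... | inj₂ ge with forward v u (≤-trans (lo#≤hi# v) (≤-trans ge (lo#≤hi# u)))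
  ...   | m , m≤d , walk = m , m≤d , reverse-walk G walk

  module _ {top} (lo≤top : All (λ x → lo x ≤ top) xs)
           (covered : ∀ j → j < top → Any (λ x → lo x ≤ j × suc j ≤ hi x) xs) where

    -- A greedy walk: each step enters an interval containing `hi# u` and the next point, which
    -- shortens the gap to `lo# v` by at least one; once the gap is closed, one step enters v.
    reach : ∀ t u v → lo# u ≤ hi# v → lo# v ≤ hi# u + t → DistLe G u v (suc t)
    reach t u v u≤v v≤u+t with u Fin.≟ v
    ... | yes refl = 0 , z≤n , here
    ... | no u≢v with lo# v ≤? hi# u
    ...   | yes v≤u = 1 , s≤s z≤n , step (edge u≢v u≤v v≤u) here
    reach zero u v u≤v v≤u+t | no _ | no v≰u = contradiction (subst (lo# v ≤_) (+-identityʳ (hi# u)) v≤u+t) v≰u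
    reach (suc t) u v u≤v v≤u+t | no _ | no v≰u
      with vertex (covered (hi# u) (<-≤-trans (≰⇒> v≰u) (All-nth lo≤top (toℕ<n v))))
    ... | w , lo-w , hi-w = further
      (edge (λ { refl → <-irrefl refl hi-w }) (≤-trans (lo#≤hi# u) (≤-trans (n≤1+n _) hi-w)) lo-w)
      (reach t w v (≤-trans lo-w (≤-trans (<⇒≤ (≰⇒> v≰u)) (lo#≤hi# v)))
             (≤-trans v≤u+t (≤-trans (≤-reflexive (+-suc (hi# u) t)) (+-monoˡ-≤ t hi-w))))

    within-1+top : ∀ u v → DistLe G u v (suc top)
    within-1+top = symmetrise λ u v u≤v → reach top u v u≤v (≤-trans (All-nth lo≤top (toℕ<n v)) (m≤n+m top (hi# u)))

    -- An interval [0 , 2] saves one step on the way out of the point 0.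
    within-top : ∀ {t} → top ≡ 2 + t → Any (λ x → lo x ≡ 0 × hi x ≡ 2) xs → ∀ u v → DistLe G u v top
    within-top {t} refl hub = symmetrise forward
      where
      forward : ∀ u v → lo# u ≤ hi# v → DistLe G u v (2 + t)
      forward u v u≤v with hi# u in eq
      ... | suc k = reach (suc t) u v u≤v (≤-trans (All-nth lo≤top (toℕ<n v))
                      (subst (2 + t ≤_) (cong (_+ suc t) (sym eq)) (s≤s (m≤n+m (suc t) k))))
      ... | zero with vertex hub
      ...   | w , lo-w , hi-w = further
        (edge (λ { refl → contradiction (trans (sym eq) hi-w) λ () })
              (≤-trans (lo#≤hi# u) (≤-trans (≤-reflexive eq) z≤n)) (≤-trans (≤-reflexive lo-w) z≤n))
        (reach t w v (≤-trans (≤-reflexive lo-w) z≤n)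
               (≤-trans (All-nth lo≤top (toℕ<n v)) (≤-reflexive (cong (_+ t) (sym hi-w)))))

  module _ (e : ℕ) (slow : All (λ x → hi x + e ≤ suc (1 ⊔ (lo x + e))) xs) where

    -- By `slow` it grows by at most one per step. For e = 1 it is `lo# u + 1`; for e = 0 the left
    -- ends 0 and 1 are identified, so that the interval [0 , 2] is allowed.
    potential : Vertex → ℕ
    potential u = 1 ⊔ (lo# u + e)

    potential-walk : ∀ {u v k} → Walk G u v k → potential v ≤ k + potential u
    potential-walk here = ≤-refl
    potential-walk {u} {v} {suc k} (step {w = w} adjacent walk) = begin
      potential v              ≤⟨ potential-walk walk ⟩
      k + potential w          ≤⟨ +-monoʳ-≤ k (⊔-lub (s≤s z≤n) (≤-trans (+-monoˡ-≤ e lo-w) (All-nth slow (toℕ<n u)))) ⟩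
      k + suc (potential u)    ≡⟨ +-suc k (potential u) ⟩
      suc k + potential u      ∎
      where
      open ≤-Reasoning
      lo-w : lo# w ≤ hi# u
      lo-w = proj₂ (Adjacent-elim {toℕ u} {toℕ w} adjacent)

    -- The first step out of an interval ending at 0 reaches left end 0, of potential 1; each
    -- further step adds at most one.
    no-short-walk : e ≤ 1 → ∀ {s z} → hi# s ≡ 0 → s ≢ z → ∀ m → m < lo# z + e → ¬ Walk G s z m
    no-short-walk e≤1 hi-s s≢z _ _ here = s≢z refl
    no-short-walk e≤1 {s} {z} hi-s s≢z (suc m) lt (step {w = w} adjacent walk) = <⇒≱ lt (begin
      lo# z + e         ≤⟨ m≤n⊔m 1 _ ⟩
      potential z       ≤⟨ potential-walk walk ⟩
      m + potential w   ≤⟨ +-monoʳ-≤ m (⊔-lub ≤-refl (≤-trans (+-monoˡ-≤ e lo-w) e≤1)) ⟩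
      m + 1             ≡⟨ +-comm m 1 ⟩
      suc m             ∎)
      where
      open ≤-Reasoning
      lo-w : lo# w ≤ 0
      lo-w = subst (lo# w ≤_) hi-s (proj₂ (Adjacent-elim {toℕ s} {toℕ w} adjacent))

-- The far vertex is taken from the tail, so it differs from the head even if the intervals
-- coincide, as they do in the complete graph of diameter 1.
far-pair : ∀ {e d x xs} → hi x ≡ 0 → Any (λ y → lo y + e ≡ d) xs →
           ∃[ s ] ∃[ z ] (hi (nth (x ∷ xs) (toℕ {length (x ∷ xs)} s)) ≡ 0 × s ≢ z ×
                          lo (nth (x ∷ xs) (toℕ {length (x ∷ xs)} z)) + e ≡ d)
far-pair {e} {d} {x} {xs} hi-x far with Any-nth far
... | i , i<n , p = zero , suc (fromℕ< i<n) , hi-x , (λ ()) ,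
      subst (λ j → lo (nth xs j) + e ≡ d) (sym (toℕ-fromℕ< i<n)) p

HasWitness : ℕ → ℕ → Set
HasWitness d h = ∃[ G ] (HasDiameter G d × FracHatChromaticEq G h)

assemble : ∀ {h} e {d x xs} → 0 < h → e ≤ 1 → (c : Certified h 0 (const 1) 1 (x ∷ xs)) (last : Any (λ y → κ y ≡ 0) (x ∷ xs)) →
  All (λ y → hi y + e ≤ suc (1 ⊔ (lo y + e))) (x ∷ xs) → hi x ≡ 0 → Any (λ y → lo y + e ≡ d) xs →
  (∀ u v → DistLe (Diameter.G (x ∷ xs) c last) u v d) → HasWitness d h
assemble e {d} {x} {xs} h>0 e≤1 c last slow hi-x far near with far-pair {e} {d} {x} {xs} hi-x far
... | s , z , hi-s , s≢z , refl =
  Diameter.G (x ∷ xs) c last ,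
  (near , s , z , Diameter.no-short-walk (x ∷ xs) c last e slow e≤1 hi-s s≢z) ,
  fracHatChromaticEq (IntervalGraph.criticalWeights (x ∷ xs) c last) h>0

-- Chains of cliques

-- The weights are w / (n w + K), … , w / (w + K) with w = 1 + α: eliminating these intervals in turn
-- lowers the product of the 1 − weight at l from n w + K to K, in units of 1 / (h w).
run : ℕ → ℕ → ℕ → ℕ → ℕ → List Interval
run l r α K zero = []
run l r α K (suc n) = iv l r α (n * suc α + K) ∷ run l r α K n

kept-inside : ∀ x {i} → i ≤ hi x → kept x i ≡ κ x
kept-inside x i≤r rewrite ≤ᵇ-true i≤r = refl

kept-outside : ∀ x {i} → hi x < i → kept x i ≡ b x
kept-outside x r<i rewrite ≤ᵇ-false r<i = refl

-- The continuation `next` sees the run only through a common factor F up to r and a factor F′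
-- beyond r. Since F′ also multiplies E, the product beyond r is unchanged, while at l it is now K
-- in units of 1 / (h w).
run-certified : ∀ {h} l r α K n {ρ D E rest} → ρ ≤ r → l ≤ r → h * suc α * D l ≡ (n * suc α + K) * E →
  (∀ F F′ D′ → (∀ j → j ≤ r → D′ j ≡ D j * F) → (∀ j → r < j → D′ j ≡ D j * F′) →
     h * suc α * D′ l ≡ K * (E * F′) → Certified h r D′ (E * F′) rest) →
  Certified h ρ D E (run l r α K n ++ rest)
run-certified {h} l r α K zero {D = D} {E} {rest} ρ≤r l≤r eq next = weaken ρ≤r
  (subst (λ E′ → Certified h r D E′ rest) (*-identityʳ E)
    (next 1 1 D (λ j _ → sym (*-identityʳ (D j))) (λ j _ → sym (*-identityʳ (D j))) (trans eq (cong (K *_) (sym (*-identityʳ E))))))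
run-certified {h} l r α K (suc n) {D = D} {E} {rest} ρ≤r l≤r eq next = add ρ≤r l≤r
  (trans eq (cong (_* E) (+-assoc (suc α) (n * suc α) K)))
  (run-certified l r α K n ≤-refl l≤r invariant λ F F′ D′ inside outside final →
    subst (λ E′ → Certified h r D′ E′ rest) (sym (*-assoc E (b x) F′))
      (next (κ x * F) (b x * F′) D′
        (λ j j≤r → trans (inside j j≤r) (trans (cong (λ k → D j * k * F) (kept-inside x j≤r)) (*-assoc (D j) (κ x) F)))
        (λ j r<j → trans (outside j r<j) (trans (cong (λ k → D j * k * F′) (kept-outside x r<j)) (*-assoc (D j) (b x) F′)))
        (trans final (cong (K *_) (*-assoc E (b x) F′)))))
  where
  open ≡-Reasoning
  x : Interval
  x = iv l r α (n * suc α + K)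
  invariant : h * suc α * (D l * kept x l) ≡ (n * suc α + K) * (E * b x)
  invariant = begin
    h * suc α * (D l * kept x l)      ≡⟨ cong (λ k → h * suc α * (D l * k)) (kept-inside x l≤r) ⟩
    h * suc α * (D l * κ x)           ≡⟨ *-assoc (h * suc α) (D l) (κ x) ⟨
    h * suc α * D l * κ x             ≡⟨ cong (_* κ x) eq ⟩
    (suc n * suc α + K) * E * κ x     ≡⟨ cong (λ k → k * E * κ x) (+-assoc (suc α) (n * suc α) K) ⟩
    b x * E * κ x                     ≡⟨ regroup (b x) E (κ x) ⟩
    κ x * (E * b x)                   ∎
    where
    regroup : ∀ x y z → x * y * z ≡ z * (y * x)
    regroup = solve-∀

All-run : ∀ {P : Interval → Set} {l r α} K n → (∀ k → P (iv l r α k)) → All P (run l r α K n)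
All-run K zero p = []
All-run K (suc n) p = p _ ∷ All-run K n p

module Families (m : ℕ) where

  h : ℕ
  h = 4 + m

  -- The chain starts where the product of the 1 − weight at i is 2 / h. Then [i , i+1] gets weight 1 / 2,
  -- [i+1 , i+2] gets weight 2 / h, and h − 4 leaves at i+2 bring the product at i+2 down to 2 / h again.
  chain : ℕ → ℕ → List Interval
  chain zero i = run i i 0 0 2 ++ []
  chain (suc k) i = iv i (1 + i) 0 1 ∷ iv (1 + i) (2 + i) 1 (2 + m) ∷ (run (2 + i) (2 + i) 0 2 m ++ chain k (2 + i))

  top : ℕ → ℕ → ℕ
  top zero i = i
  top (suc k) i = top k (2 + i)

  i≤top : ∀ k i → i ≤ top k i
  i≤top zero i = ≤-refl
  i≤top (suc k) i = ≤-trans (m≤n+m i 2) (i≤top k (2 + i))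

  chain-lo : ∀ k i → All (λ x → lo x ≤ top k i) (chain k i)
  chain-lo zero i = Allₚ.++⁺ (All-run {l = i} {i} {0} 0 2 (λ _ → ≤-refl)) []
  chain-lo (suc k) i = i≤top (suc k) i ∷ ≤-trans (n≤1+n _) (i≤top k (2 + i)) ∷
    Allₚ.++⁺ (All-run {l = 2 + i} {2 + i} {0} 2 m (λ _ → i≤top k (2 + i))) (chain-lo k (2 + i))

  chain-short : ∀ k i → All (λ x → hi x ≤ suc (lo x)) (chain k i)
  chain-short zero i = Allₚ.++⁺ (All-run {l = i} {i} {0} 0 2 (λ _ → n≤1+n i)) []
  chain-short (suc k) i = ≤-refl ∷ ≤-refl ∷
    Allₚ.++⁺ (All-run {l = 2 + i} {2 + i} {0} 2 m (λ _ → n≤1+n _)) (chain-short k (2 + i))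

  chain-covered : ∀ k i j → i ≤ j → j < top k i → Any (λ x → lo x ≤ j × suc j ≤ hi x) (chain k i)
  chain-covered zero i j i≤j j<i = contradiction i≤j (<⇒≱ j<i)
  chain-covered (suc k) i j i≤j j<top with m≤n⇒m<n∨m≡n i≤j
  ... | inj₂ refl = here (≤-refl , ≤-refl)
  ... | inj₁ i<j with m≤n⇒m<n∨m≡n i<j
  ...   | inj₂ refl = there (here (≤-refl , ≤-refl))
  ...   | inj₁ 1+i<j = there (there (Anyₚ.++⁺ʳ (run (2 + i) (2 + i) 0 2 m) (chain-covered k (2 + i) j 1+i<j j<top)))

  chain-end : ∀ k i → Any (λ x → lo x ≡ top k i) (chain k i)
  chain-end zero i = here refl
  chain-end (suc k) i = there (there (Anyₚ.++⁺ʳ (run (2 + i) (2 + i) 0 2 m) (chain-end k (2 + i))))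

  -- The final run has K = 0, so its second and last interval has weight 1.
  chain-last : ∀ k i → Any (λ x → κ x ≡ 0) (chain k i)
  chain-last zero i = there (here refl)
  chain-last (suc k) i = there (there (Anyₚ.++⁺ʳ (run (2 + i) (2 + i) 0 2 m) (chain-last k (2 + i))))

  -- The invariant at i is: product 2 / h at i and 1 beyond. At i + 1 the product becomes 1 / 2,
  -- which fits the weight 2 / h; at i + 2 it becomes 1 - 2 / h = (m + 2) / h, and m further
  -- intervals restore 2 / h.
  chain-certified : ∀ k i {ρ D E} → ρ ≤ i → h * D i ≡ 2 * E → (∀ j → i < j → D j ≡ E) → Certified h ρ D E (chain k i)
  chain-certified zero i {D = D} ρ≤i eq _ =
    run-certified i i 0 0 2 ρ≤i ≤-refl (trans (cong (_* D i) (*-identityʳ h)) eq) λ _ _ _ _ _ _ → []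
  chain-certified (suc k) i {D = D} {E} ρ≤i eq fresh =
    add (≤-trans ρ≤i (n≤1+n i)) (n≤1+n i) (trans (cong (_* D i) (*-identityʳ h)) eq)
    (add (n≤1+n _) (n≤1+n _)
      (trans (cong (λ k → h * 2 * k) D₁) (first h E))
      (run-certified (2 + i) (2 + i) 0 2 m ≤-refl ≤-refl
        (trans (cong (λ k → h * 1 * k) D₂) (second m E))
        λ F F′ D′ inside outside final → chain-certified k (2 + i) ≤-refl
          (trans (cong (_* D′ (2 + i)) (sym (*-identityʳ h))) final)
          λ j lt → trans (outside j lt) (cong (_* F′) (beyond j lt))))
    where
    x y : Interval
    x = iv i (1 + i) 0 1
    y = iv (1 + i) (2 + i) 1 (2 + m)
    D₁ : D (1 + i) * kept x (1 + i) ≡ E * 1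
    D₁ = cong₂ _*_ (fresh (1 + i) ≤-refl) (kept-inside x ≤-refl)
    D₂ : D (2 + i) * kept x (2 + i) * kept y (2 + i) ≡ E * 2 * (2 + m)
    D₂ = cong₂ _*_ (cong₂ _*_ (fresh (2 + i) (n≤1+n _)) (kept-outside x ≤-refl)) (kept-inside y ≤-refl)
    beyond : ∀ j → 2 + i < j → D j * kept x j * kept y j ≡ E * 2 * b y
    beyond j lt = cong₂ _*_ (cong₂ _*_ (fresh j (<-trans (n<1+n i) (<-trans (n<1+n _) lt))) (kept-outside x (<-trans (n<1+n _) lt))) (kept-outside y lt)
    first : ∀ h E → h * 2 * (E * 1) ≡ h * (E * 2)
    first = solve-∀
    second : ∀ m E → (4 + m) * 1 * (E * 2 * (2 + m)) ≡ (m * 1 + 2) * (E * 2 * (4 + m))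
    second = solve-∀

  -- The h - 2 intervals at the point 0 lower the product there from 1 to 2 / h, as the chain
  -- requires.
  odd-diameter : ∀ k → HasWitness (suc (top k 0)) h
  odd-diameter k = assemble 1 (s≤s z≤n) ≤-refl c last slow refl end
    (Diameter.within-1+top xs c last (Allₚ.++⁺ (All-run {l = 0} {0} {0} 2 (2 + m) (λ _ → z≤n)) (chain-lo k 0))
      λ j j<top → Anyₚ.++⁺ʳ (run 0 0 0 2 (2 + m)) (chain-covered k 0 j z≤n j<top))
    where
    xs : List Interval
    xs = run 0 0 0 2 (2 + m) ++ chain k 0
    c : Certified h 0 (const 1) 1 xs
    c = run-certified 0 0 0 2 (2 + m) z≤n z≤n (start m) λ F F′ D′ inside outside final →
          chain-certified k 0 z≤n (trans (cong (_* D′ 0) (sym (*-identityʳ h))) final) λ j lt → outside j lt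
      where
      start : ∀ m → (4 + m) * 1 * 1 ≡ ((2 + m) * 1 + 2) * 1
      start = solve-∀
    last : Any (λ x → κ x ≡ 0) xs
    last = Anyₚ.++⁺ʳ (run 0 0 0 2 (2 + m)) (chain-last k 0)
    slow : All (λ x → hi x + 1 ≤ suc (1 ⊔ (lo x + 1))) xs
    slow = Allₚ.++⁺ (All-run {l = 0} {0} {0} 2 (2 + m) (λ _ → s≤s z≤n))
      (All.map (λ {x} short → ≤-trans (+-monoˡ-≤ 1 short) (s≤s (m≤n⊔m 1 (lo x + 1)))) (chain-short k 0))
    end : Any (λ x → lo x + 1 ≡ suc (top k 0)) (run 0 0 0 2 (1 + m) ++ chain k 0)
    end = Anyₚ.++⁺ʳ (run 0 0 0 2 (1 + m)) (Any.map (λ {x} e → trans (+-comm (lo x) 1) (cong suc e)) (chain-end k 0))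

  -- The cliques at the points 0, 1 and 2 share the interval [0 , 2], whose length 2 saves one step
  -- and changes the parity.
  even-diameter : ∀ k → HasWitness (top k 2) h
  even-diameter k = assemble 0 (s≤s z≤n) z≤n c last slow refl end
    (Diameter.within-top xs c last
      (z≤n ∷ z≤n ∷ z≤n ∷ Allₚ.++⁺ (All-run {l = 1} {2} {2 + m} _ m (λ _ → ≤-trans (s≤s z≤n) (i≤top k 2))) (chain-lo k 2))
      covered (sym (proj₂ (m≤n⇒∃[o]m+o≡n (i≤top k 2)))) (there (there (here (refl , refl)))))
    where
    W : List Interval
    -- These m intervals lower the product at 1 from (m + 1) / (m + 3) to 2 (m + 2) / (h (m + 3)).
    -- The point 2 is not reached by [0 , 1], so its product is larger by the factor (m + 3) / (m +
    -- 2): exactly the 2 / h at which the chain starts.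
    W = run 1 2 (2 + m) (2 * (2 + m)) m
    tail : List Interval
    tail = iv 0 1 0 (2 + m) ∷ iv 0 2 0 (1 + m) ∷ (W ++ chain k 2)
    xs : List Interval
    xs = iv 0 0 0 (3 + m) ∷ tail
    c : Certified h 0 (const 1) 1 xs
    c = add z≤n z≤n (eq₁ m) (add z≤n z≤n (eq₂ m) (add (s≤s z≤n) z≤n (eq₃ m)
          (run-certified 1 2 (2 + m) (2 * (2 + m)) m ≤-refl (s≤s z≤n) (eq₄ m) next)))
      where
      eq₁ : ∀ m → (4 + m) * 1 * 1 ≡ (4 + m) * 1
      eq₁ = solve-∀
      eq₂ : ∀ m → (4 + m) * 1 * (1 * (3 + m)) ≡ (3 + m) * (1 * (4 + m))
      eq₂ = solve-∀
      eq₃ : ∀ m → (4 + m) * 1 * (1 * (3 + m) * (2 + m)) ≡ (2 + m) * (1 * (4 + m) * (3 + m))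
      eq₃ = solve-∀
      eq₄ : ∀ m → (4 + m) * (3 + m) * (1 * (4 + m) * (2 + m) * (1 + m)) ≡
                  (m * (3 + m) + 2 * (2 + m)) * (1 * (4 + m) * (3 + m) * (2 + m))
      eq₄ = solve-∀
      E : ℕ
      E = 1 * (4 + m) * (3 + m) * (2 + m)
      next : ∀ F F′ D′ →
        (∀ j → j ≤ 2 → D′ j ≡ 1 * kept (iv 0 0 0 (3 + m)) j * kept (iv 0 1 0 (2 + m)) j * kept (iv 0 2 0 (1 + m)) j * F) →
        (∀ j → 2 < j → D′ j ≡ 1 * kept (iv 0 0 0 (3 + m)) j * kept (iv 0 1 0 (2 + m)) j * kept (iv 0 2 0 (1 + m)) j * F′) →
        h * (3 + m) * D′ 1 ≡ 2 * (2 + m) * (E * F′) → Certified h 2 D′ (E * F′) (chain k 2)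
      next F F′ D′ inside outside final = chain-certified k 2 ≤-refl
        (*-cancelˡ-≡ _ _ (2 + m) (begin
          (2 + m) * (h * D′ 2)
            ≡⟨ cong (λ x → (2 + m) * (h * x)) (inside 2 ≤-refl) ⟩
          (2 + m) * ((4 + m) * (1 * (4 + m) * (3 + m) * (1 + m) * F))
            ≡⟨ ratio m F ⟩
          (4 + m) * (3 + m) * (1 * (4 + m) * (2 + m) * (1 + m) * F)
            ≡⟨ cong (λ x → h * (3 + m) * x) (inside 1 (s≤s z≤n)) ⟨
          h * (3 + m) * D′ 1
            ≡⟨ final ⟩
          2 * (2 + m) * (E * F′)
            ≡⟨ regroup (2 + m) (E * F′) ⟩
          (2 + m) * (2 * (E * F′)) ∎))
        λ { (suc (suc (suc j))) lt → outside (3 + j) lt ; (suc (suc zero)) (s≤s (s≤s ())) ; (suc zero) (s≤s ()) }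
        where
        open ≡-Reasoning
        ratio : ∀ m F → (2 + m) * ((4 + m) * (1 * (4 + m) * (3 + m) * (1 + m) * F)) ≡
                        (4 + m) * (3 + m) * (1 * (4 + m) * (2 + m) * (1 + m) * F)
        ratio = solve-∀
        regroup : ∀ x y → 2 * x * y ≡ x * (2 * y)
        regroup = solve-∀
    last : Any (λ x → κ x ≡ 0) xs
    last = there (there (there (Anyₚ.++⁺ʳ W (chain-last k 2))))
    covered : ∀ j → j < top k 2 → Any (λ x → lo x ≤ j × suc j ≤ hi x) xs
    covered 0 _ = there (here (z≤n , ≤-refl))
    covered 1 _ = there (there (here (z≤n , ≤-refl)))
    covered (suc (suc j)) lt = there (there (there (Anyₚ.++⁺ʳ W (chain-covered k 2 (2 + j) (s≤s (s≤s z≤n)) lt))))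
    slow : All (λ x → hi x + 0 ≤ suc (1 ⊔ (lo x + 0))) xs
    slow = z≤n ∷ s≤s z≤n ∷ ≤-refl ∷ Allₚ.++⁺ (All-run {l = 1} {2} {2 + m} _ m (λ _ → ≤-refl))
      (All.map (λ {x} short → ≤-trans (+-monoˡ-≤ 0 short) (s≤s (m≤n⊔m 1 (lo x + 0)))) (chain-short k 2))
    end : Any (λ x → lo x + 0 ≡ top k 2) tail
    end = there (there (Anyₚ.++⁺ʳ W (Any.map (λ {x} e → trans (+-identityʳ (lo x)) e) (chain-end k 2))))

  top-+2 : ∀ k i → top k (2 + i) ≡ 2 + top k i
  top-+2 zero i = refl
  top-+2 (suc k) i = top-+2 k (2 + i)

  parity : ∀ d → (∃[ k ] suc d ≡ suc (top k 0)) ⊎ (∃[ k ] suc d ≡ top k 2)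
  parity zero = inj₁ (0 , refl)
  parity (suc d) with parity d
  ... | inj₁ (k , e) = inj₂ (k , trans (cong suc e) (sym (top-+2 k 0)))
  ... | inj₂ (k , e) = inj₁ (suc k , cong suc e)

theorem6p4 : ∀ (d h : ℕ) → 1 ≤ d → 3 < h →
    ∃[ G ] (HasDiameter G d × FracHatChromaticEq G h)
theorem6p4 (suc d) (suc (suc (suc (suc m)))) _ (s≤s (s≤s (s≤s (s≤s _)))) with Families.parity m d
... | inj₁ (k , e) = subst (λ d → HasWitness d (4 + m)) (sym e) (Families.odd-diameter m k)
... | inj₂ (k , e) = subst (λ d → HasWitness d (4 + m)) (sym e) (Families.even-diameter m k)
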